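{- Let $X$ be a Polish space and $d$ a pseudo-metric on $X$. If the set $\{(u,v)\in X^2: d(u,v)<\delta\}$ is $\mathbf{\Pi}^1_1$ for each $\delta>0$, then either $(X,d)$ is separable or there are $\delta>0$ and a perfect set $C\subseteq X$ such that $d(u,v)\ge\delta$ for all distinct $u,v\in C$.
   Context: A Polish space is a separable, completely metrizable topological space. The pseudo-metric $d$ is not assumed to be related to the topology of $X$. $\mathbf{\Pi}^1_1$ denotes the class of coanalytic sets, here in the Polish space $X^2$ (with the product of the Polish topology of $X$). Separability of $(X,d)$ refers to the pseudo-metric topology of $d$: there is a countable $S\subseteq X$ such that for every $u\in X$ and every $\varepsilon>0$ there is $s\in S$ with $d(u,s)<\varepsilon$. A perfect set is a nonempty closed set without isolated points, with respect to the Polish topology of $X$. -}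

module Defs where

open import Level using (Level; 0ℓ; _⊔_; suc)
open import Data.Nat.Base as ℕ using (ℕ)
import Data.Nat.Properties as ℕ
open import Data.Rational.Base as ℚ using (ℚ; 0ℚ; 1ℚ)
import Data.Rational.Properties as ℚ
open import Data.Product.Base using (Σ; ∃-syntax; _×_; _,_)
open import Data.Sum.Base using (_⊎_)
open import Function.Bundles using (_⇔_)
open import Relation.Binary.PropositionalEquality
  using (_≡_; refl; trans; cong; subst)
open import Relation.Nullary using (¬_; yes; no; contradiction)
open import Relation.Unary
  using (Pred; _∈_; _∉_; _⊆_; _≐_; _∩_; ∁; ⋃; Satisfiable; Empty; _⊢_; _⟨×⟩_)

private
  variable
    a b ℓ o o′ s : Level
    A B : Set a

-- Real numbers as lower Dedekind cuts: proper nonempty downward closed sets of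
-- rationals without a largest element.  These are the usual reals under
-- excluded middle; constructively they would be a larger collection.

record ℝ : Set₁ where
  field
    cut       : Pred ℚ 0ℓ
    inhabited : ∃[ q ] q ∈ cut
    proper    : ∃[ q ] q ∉ cut
    lower     : ∀ {p q} → p ℚ.< q → q ∈ cut → p ∈ cut
    open-up   : ∀ {p} → p ∈ cut → ∃[ q ] p ℚ.< q × q ∈ cut

open ℝ

infix 4 _≤_ _<_ _≈_
infixl 6 _+_

_≤_ : ℝ → ℝ → Set
x ≤ y = cut x ⊆ cut y

_<_ : ℝ → ℝ → Set
x < y = ∃[ q ] q ∉ cut x × q ∈ cut y

_≈_ : ℝ → ℝ → Set
x ≈ y = cut x ≐ cut y

0ℝ : ℝ
0ℝ .cut q = q ℚ.< 0ℚ
0ℝ .inhabited = ℚ.- 1ℚ , ℚ.negative⁻¹ (ℚ.- 1ℚ)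
0ℝ .proper = 0ℚ , ℚ.<-irrefl refl
0ℝ .lower = ℚ.<-trans
0ℝ .open-up = ℚ.<-dense

private
  ∉⇒upper : ∀ x {p q} → p ∈ cut x → q ∉ cut x → p ℚ.< q
  ∉⇒upper x {p} {q} p∈x q∉x with p ℚ.<? q
  ... | yes p<q = p<q
  ... | no p≮q with q ℚ.≟ p
  ...   | yes refl = contradiction p∈x q∉x
  ...   | no q≢p = contradiction (lower x q<p p∈x) q∉x
    where q<p = ℚ.≰⇒> λ p≤q → q≢p (ℚ.≤-antisym (ℚ.≮⇒≥ p≮q) p≤q)

  cancel : ∀ q r → (q ℚ.- r) ℚ.+ r ≡ q
  cancel q r = trans (ℚ.+-assoc q (ℚ.- r) r)
    (trans (cong (q ℚ.+_) (ℚ.+-inverseˡ r)) (ℚ.+-identityʳ q))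

  cancel′ : ∀ q r → (q ℚ.+ r) ℚ.- r ≡ q
  cancel′ q r = trans (ℚ.+-assoc q r (ℚ.- r))
    (trans (cong (q ℚ.+_) (ℚ.+-inverseʳ r)) (ℚ.+-identityʳ q))

_+_ : ℝ → ℝ → ℝ
(x + y) .cut q = ∃[ r ] ∃[ t ] r ∈ cut x × t ∈ cut y × r ℚ.+ t ≡ q
(x + y) .inhabited =
  let r , r∈x = inhabited x
      t , t∈y = inhabited y
  in  r ℚ.+ t , r , t , r∈x , t∈y , refl
(x + y) .proper =
  let p , p∉x = proper x
      q , q∉y = proper y
  in  p ℚ.+ q , λ (r , t , r∈x , t∈y , eq) →
        ℚ.<-irrefl eq (ℚ.+-mono-< (∉⇒upper x r∈x p∉x) (∉⇒upper y t∈y q∉y))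
(x + y) .lower {p} p<q (r , t , r∈x , t∈y , refl) =
  p ℚ.- t , t , lower x p-t<r r∈x , t∈y , cancel p t
  where
  p-t<r : p ℚ.- t ℚ.< r
  p-t<r = subst (p ℚ.- t ℚ.<_) (cancel′ r t) (ℚ.+-monoˡ-< (ℚ.- t) p<q)
(x + y) .open-up (r , t , r∈x , t∈y , refl) =
  let r′ , r<r′ , r′∈x = open-up x r∈x
  in  r′ ℚ.+ t , ℚ.+-monoˡ-< t r<r′ , r′ , t , r′∈x , t∈y , refl

-- The open sets form a family of level-ℓ predicates, and unions are taken over
-- index types of level ℓ.  For A : Set a with a ≤ ℓ this is no restriction
-- classically: a union of any family of subsets of A is already the union of a
-- subfamily indexed by its own points.

record Topology (A : Set a) (ℓ o : Level) : Set (a ⊔ suc (ℓ ⊔ o)) where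
  field
    Open      : Pred (Pred A ℓ) o
    open-resp : ∀ {V W} → V ≐ W → Open V → Open W
    open-univ : ∀ {V} → (∀ x → x ∈ V) → Open V
    open-∩    : ∀ {V W} → Open V → Open W → Open (V ∩ W)
    open-⋃    : ∀ {I : Set ℓ} (V : I → Pred A ℓ) →
                (∀ i → Open (V i)) → Open (⋃ I V)

open Topology public using (Open)

Continuous : Topology A ℓ o → Topology B ℓ o′ → (A → B) → Set _
Continuous σ τ f = ∀ {V} → Open τ V → Open σ (f ⊢ V)

infixr 2 _⊗_

_⊗_ : {A : Set a} {B : Set b} →
      Topology A ℓ o → Topology B ℓ o′ → Topology (A × B) ℓ (a ⊔ b ⊔ suc ℓ ⊔ o ⊔ o′)
_⊗_ {ℓ = ℓ} {A = A} {B = B} σ τ = record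
  { Open      = λ W → ∀ p → p ∈ W → Box W p
  ; open-resp = λ (V⊆W , W⊆V) oV p p∈W →
      let G , H , oG , oH , p∈ , sub = oV p (W⊆V p∈W)
      in  G , H , oG , oH , p∈ , λ q∈ → V⊆W (sub q∈)
  ; open-univ = λ all p _ →
      (λ _ → Full) , (λ _ → Full) , σ.open-univ (λ _ → full) , τ.open-univ (λ _ → full)
      , (full , full) , λ {q} _ → all q
  ; open-∩    = λ oV oW p (p∈V , p∈W) →
      let G  , H  , oG  , oH  , (g  , h)  , sub  = oV p p∈V
          G′ , H′ , oG′ , oH′ , (g′ , h′) , sub′ = oW p p∈W
      in  G ∩ G′ , H ∩ H′ , σ.open-∩ oG oG′ , τ.open-∩ oH oH′ , ((g , g′) , (h , h′))
          , λ ((x , x′) , (y , y′)) → sub (x , y) , sub′ (x′ , y′)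
  ; open-⋃    = λ V oV p (i , p∈) →
      let G , H , oG , oH , p∈′ , sub = oV i p p∈
      in  G , H , oG , oH , p∈′ , λ q∈ → i , sub q∈
  }
  where
  module σ = Topology σ
  module τ = Topology τ
  open import Data.Unit.Polymorphic.Base using () renaming (⊤ to Full; tt to full)

  Box : Pred (A × B) ℓ → A × B → Set _
  Box W p = ∃[ G ] ∃[ H ] Open σ G × Open τ H × p ∈ (G ⟨×⟩ H) × (G ⟨×⟩ H) ⊆ W

-- Product topology of discrete spaces: basic open neighbourhoods of α consist
-- of the sequences extending an initial segment of α.

baire : ∀ ℓ → Topology (ℕ → ℕ) ℓ ℓ
baire ℓ = record
  { Open      = λ V → ∀ α → α ∈ V → ∃[ n ] ∀ β → α ≡[ n ] β → β ∈ V
  ; open-resp = λ (V⊆W , W⊆V) oV α α∈W →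
      let n , h = oV α (W⊆V α∈W) in n , λ β e → V⊆W (h β e)
  ; open-univ = λ all α _ → 0 , λ β _ → all β
  ; open-∩    = λ oV oW α (α∈V , α∈W) →
      let m , h = oV α α∈V
          n , k = oW α α∈W
      in  m ℕ.⊔ n , λ β e →
            h β (λ i i<m → e i (ℕ.<-≤-trans i<m (ℕ.m≤m⊔n m n)))
          , k β (λ i i<n → e i (ℕ.<-≤-trans i<n (ℕ.m≤n⊔m m n)))
  ; open-⋃    = λ V oV α (i , α∈) →
      let n , h = oV i α α∈ in n , λ β e → i , h β e
  }
  where
  _≡[_]_ : (ℕ → ℕ) → ℕ → (ℕ → ℕ) → Set
  α ≡[ n ] β = ∀ i → i ℕ.< n → α i ≡ β i

-- "At most countable": finite and empty sets are included.

Countable : {A : Set a} → Pred A ℓ → Set _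
Countable {A = A} S =
  Σ (A → ℕ) λ f → ∀ x y → x ∈ S → y ∈ S → f x ≡ f y → x ≡ y

Separable : {A : Set a} → Topology A ℓ o → Set _
Separable {ℓ = ℓ} {A = A} τ = Σ (Pred A ℓ) λ S →
  Countable S × (∀ V → Open τ V → Satisfiable V → Satisfiable (S ∩ V))

record IsPseudoMetric {A : Set a} (d : A → A → ℝ) : Set a where
  field
    nonNegative : ∀ x y → 0ℝ ≤ d x y
    reflexive   : ∀ x → d x x ≈ 0ℝ
    symmetric   : ∀ x y → d x y ≈ d y x
    triangle    : ∀ x y z → d x z ≤ d x y + d y z

record IsMetric {A : Set a} (ρ : A → A → ℝ) : Set a where
  field
    isPseudoMetric : IsPseudoMetric ρ
    separated      : ∀ x y → ρ x y ≈ 0ℝ → x ≡ y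

Cauchy : (A → A → ℝ) → (ℕ → A) → Set _
Cauchy ρ x = ∀ ε → 0ℝ < ε → ∃[ N ] ∀ m n → N ℕ.≤ m → N ℕ.≤ n → ρ (x m) (x n) < ε

ConvergesTo : (A → A → ℝ) → (ℕ → A) → A → Set _
ConvergesTo ρ x l = ∀ ε → 0ℝ < ε → ∃[ N ] ∀ n → N ℕ.≤ n → ρ (x n) l < ε

Complete : (A → A → ℝ) → Set _
Complete ρ = ∀ x → Cauchy ρ x → ∃[ l ] ConvergesTo ρ x l

MetricOpen : {A : Set a} → (A → A → ℝ) → Pred A ℓ → Set _
MetricOpen ρ V = ∀ x → x ∈ V → ∃[ ε ] 0ℝ < ε × (∀ y → ρ x y < ε → y ∈ V)

CompletelyMetrizable : {A : Set a} → Topology A ℓ o → Set _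
CompletelyMetrizable {A = A} τ = Σ (A → A → ℝ) λ ρ →
  IsMetric ρ × Complete ρ × (∀ V → Open τ V ⇔ MetricOpen ρ V)

IsPolish : {A : Set a} → Topology A ℓ o → Set _
IsPolish τ = Separable τ × CompletelyMetrizable τ

-- Boldface Σ¹₁: empty, or a continuous image of the Baire space.

Analytic : {A : Set a} → Topology A ℓ o → Pred A s → Set _
Analytic {ℓ = ℓ} {A = A} τ S = Empty S ⊎
  (Σ ((ℕ → ℕ) → A) λ f →
    Continuous (baire ℓ) τ f × (∀ x → x ∈ S ⇔ (∃[ α ] f α ≡ x)))

Coanalytic : {A : Set a} → Topology A ℓ o → Pred A s → Set _
Coanalytic τ S = Analytic τ (∁ S)

PseudoMetricSeparable : ∀ {a} {A : Set a} → (A → A → ℝ) → Set (suc a)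
PseudoMetricSeparable {a} {A} d = Σ (Pred A a) λ S →
  Countable S × (∀ u ε → 0ℝ < ε → ∃[ s ] s ∈ S × d u s < ε)

Isolated : {A : Set a} → Topology A ℓ o → Pred A ℓ → A → Set _
Isolated τ C x = ∃[ V ] Open τ V × x ∈ V × (∀ y → y ∈ C → y ∈ V → y ≡ x)

Perfect : {A : Set a} → Topology A ℓ o → Pred A ℓ → Set _
Perfect τ C = Satisfiable C × Open τ (∁ C) × (∀ x → x ∈ C → ¬ Isolated τ C x)

{-# OPTIONS --safe #-}

-- Let R be the analytic relation d(u,v) ≥ δ.  If X splits into countably many
-- R-independent sets for every δ = 1/(k+1), then choosing one point from each
-- of them gives a countable dense set.  Otherwise fix δ.  The subsets of X
-- which are countable unions of R-independent sets form a σ-ideal, and a finite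
-- configuration whose edges carry witnesses for the analyticity of R is kept if
-- it can be realised outside every set of the ideal.  Since there are only
-- countably many approximations to configurations, two copies can always be
-- joined by a new edge, and in the limit one gets a continuous φ : 2^ω → X
-- sending the edges of G₀ to pairs in R.
--
-- Let R′ be the analytic relation d(u,v) ≥ δ/2.  Given a box of 2^ω × 2^ω and
-- countably many dense open sets, there are a G₀-edge x, x′ and a point y with
-- (x,y) and (x′,y) in the box and in all of the dense open sets; by the triangle
-- inequality one of (φ x, φ y), (φ x′, φ y) is in R′.  Hence the preimage of R′
-- is nonmeager in every box, and a fusion which lengthens codes for R′ while
-- keeping the coded sets nonmeager in every subbox gives a copy of 2^ω whose
-- distinct points are mapped by φ to R′-related points.

module Submission where

open import Defs
open import Level using (Level; Lift; lift; 0ℓ; _⊔_)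
open import Axiom.ExcludedMiddle using (ExcludedMiddle)
open import Data.Bool.Base using (Bool; true; false; if_then_else_; not)
open import Data.Bool.Properties using (not-¬)
open import Data.List.Base using (List; []; _∷_; cartesianProduct)
open import Data.List.Membership.Propositional using () renaming (_∈_ to _∈ˡ_)
open import Data.List.Membership.Propositional.Properties using (∈-cartesianProduct⁺)
open import Data.List.Relation.Unary.Any using (here; there)
open import Data.Nat.Base as ℕ using (ℕ; zero; suc; z≤n; s≤s)
import Data.Nat.Properties as ℕ
open import Data.Nat.Coprimality using (1-coprimeTo)
import Data.Integer.Base as ℤ
import Data.Integer.Properties as ℤ
open import Data.Rational.Base as ℚ using (ℚ; mkℚ; 0ℚ; 1ℚ)
import Data.Rational.Properties as ℚ
open import Data.Product.Base using (Σ; ∃-syntax; _×_; _,_; proj₁; proj₂)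
open import Data.Sum.Base using (_⊎_; inj₁; inj₂)
open import Data.Empty using (⊥)
open import Data.Unit.Base using (⊤; tt)
open import Function.Base using (_∘_; case_of_)
open import Function.Bundles using (_⇔_; Equivalence)
open import Relation.Binary.PropositionalEquality
  using (_≡_; _≢_; refl; sym; trans; cong; cong₂; subst; subst₂)
open import Relation.Nullary using (¬_; Dec; yes; no; contradiction)
open import Relation.Nullary.Decidable using (True; toWitness; fromWitness; decidable-stable)
open import Relation.Unary using (Pred; _∈_; _∉_; _∩_; ∁; _⊢_)

open ℝ using (cut; lower; open-up)

private
  variable
    a b ℓ ℓ′ o : Level
    A : Set a

-- Enumeration of pairs along the antidiagonals.

next : ℕ × ℕ → ℕ × ℕ
next (zero , n) = suc n , 0
next (suc m , n) = m , suc n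

unpair : ℕ → ℕ × ℕ
unpair zero = 0 , 0
unpair (suc n) = next (unpair n)

Reached : ℕ × ℕ → Set
Reached p = ∃[ n ] unpair n ≡ p

reached-next : ∀ {p} → Reached p → Reached (next p)
reached-next (n , eq) = suc n , cong next eq

reached-antidiagonal : ∀ n m → Reached (n ℕ.+ m , 0) → Reached (m , n)
reached-antidiagonal zero m r = r
reached-antidiagonal (suc n) m r =
  reached-next (reached-antidiagonal n (suc m) (subst (λ k → Reached (k , 0)) (sym (ℕ.+-suc n m)) r))

reached-axis : ∀ m → Reached (m , 0)
reached-axis zero = 0 , refl
reached-axis (suc m) = reached-next
  (reached-antidiagonal m 0 (subst (λ k → Reached (k , 0)) (sym (ℕ.+-identityʳ m)) (reached-axis m)))

unpair-surjective : ∀ p → Reached p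
unpair-surjective (m , n) = reached-antidiagonal n m (reached-axis (n ℕ.+ m))

abstract
  pair : ℕ → ℕ → ℕ
  pair m n = proj₁ (unpair-surjective (m , n))

  unpair-pair : ∀ m n → unpair (pair m n) ≡ (m , n)
  unpair-pair m n = proj₂ (unpair-surjective (m , n))

pair-injective : ∀ {m n m′ n′} → pair m n ≡ pair m′ n′ → (m , n) ≡ (m′ , n′)
pair-injective {m} {n} {m′} {n′} eq =
  trans (sym (unpair-pair m n)) (trans (cong unpair eq) (unpair-pair m′ n′))

unpair-bounded : ∀ n → proj₁ (unpair n) ℕ.+ proj₂ (unpair n) ℕ.≤ n
unpair-bounded zero = z≤n
unpair-bounded (suc n) = ℕ.≤-trans (next-bounded (unpair n)) (s≤s (unpair-bounded n))
  where
  next-bounded : ∀ p → proj₁ (next p) ℕ.+ proj₂ (next p) ℕ.≤ suc (proj₁ p ℕ.+ proj₂ p)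
  next-bounded (zero , n) = s≤s (ℕ.≤-reflexive (ℕ.+-identityʳ n))
  next-bounded (suc m , n) = ℕ.≤-trans (ℕ.≤-reflexive (ℕ.+-suc m n)) (ℕ.n≤1+n _)

m≤pair : ∀ m n → m ℕ.≤ pair m n
m≤pair m n = ℕ.≤-trans (ℕ.m≤m+n m n)
  (subst (λ p → proj₁ p ℕ.+ proj₂ p ℕ.≤ pair m n) (unpair-pair m n) (unpair-bounded (pair m n)))

-- Agreement on initial segments, and diagonal limits of sequences.

infix 4 _≈[_]_

_≈[_]_ : {A : Set a} → (ℕ → A) → ℕ → (ℕ → A) → Set a
x ≈[ n ] y = ∀ i → i ℕ.< n → x i ≡ y i

≈-refl : ∀ {A : Set a} {x : ℕ → A} {n} → x ≈[ n ] x
≈-refl i i<n = refl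

≈-sym : ∀ {A : Set a} {x y : ℕ → A} {n} → x ≈[ n ] y → y ≈[ n ] x
≈-sym e i i<n = sym (e i i<n)

≈-trans : ∀ {A : Set a} {x y z : ℕ → A} {n} → x ≈[ n ] y → y ≈[ n ] z → x ≈[ n ] z
≈-trans e f i i<n = trans (e i i<n) (f i i<n)

≈-mono : ∀ {A : Set a} {x y : ℕ → A} {m n} → m ℕ.≤ n → x ≈[ n ] y → x ≈[ m ] y
≈-mono m≤n e i i<m = e i (ℕ.<-≤-trans i<m m≤n)

≈-map : ∀ {A : Set a} {B : Set b} (f : A → B) {x y : ℕ → A} {n} →
        x ≈[ n ] y → f ∘ x ≈[ n ] f ∘ y
≈-map f e i i<n = cong f (e i i<n)

prefixCode : ℕ → (ℕ → ℕ) → ℕ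
prefixCode zero w = 0
prefixCode (suc m) w = pair (w m) (prefixCode m w)

prefixCode-injective : ∀ m {v w} → prefixCode m v ≡ prefixCode m w → v ≈[ m ] w
prefixCode-injective (suc m) {v} {w} eq i (s≤s i≤m)
  with ℕ.m≤n⇒m<n∨m≡n i≤m
     | pair-injective eq
... | inj₁ i<m | eqs = prefixCode-injective m (cong proj₂ eqs) i i<m
... | inj₂ refl | eqs = cong proj₁ eqs

infixl 6 _[_]≔_

_[_]≔_ : {A : Set a} → (ℕ → A) → ℕ → A → ℕ → A
(x [ n ]≔ v) i with i ℕ.≟ n
... | yes _ = v
... | no _ = x i

updated : ∀ {A : Set a} (x : ℕ → A) n v → (x [ n ]≔ v) n ≡ v
updated x n v with n ℕ.≟ n
... | yes _ = refl
... | no n≢n = contradiction refl n≢n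

unchanged : ∀ {A : Set a} (x : ℕ → A) {n v i} → i ≢ n → (x [ n ]≔ v) i ≡ x i
unchanged x {n} {v} {i} i≢n with i ℕ.≟ n
... | yes i≡n = contradiction i≡n i≢n
... | no _ = refl

updated-≈ : ∀ {A : Set a} (x : ℕ → A) n v → (x [ n ]≔ v) ≈[ n ] x
updated-≈ x n v i i<n = unchanged x (ℕ.<⇒≢ i<n)

≈-extend : ∀ {A : Set a} {x y : ℕ → A} {n} →
           x ≈[ n ] y → x ≈[ suc n ] y [ n ]≔ x n
≈-extend {x = x} {y} {n} e i (s≤s i≤n) with i ℕ.≟ n
... | yes refl = refl
... | no i≢n = e i (ℕ.≤∧≢⇒< i≤n i≢n)

diagonal : {A : Set a} → (ℕ → ℕ → A) → ℕ → A
diagonal w i = w i i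

module _ {A : Set a} (w : ℕ → ℕ → A) (len : ℕ → ℕ)
  (long : ∀ i → i ℕ.< len i) (grow : ∀ i → len i ℕ.≤ len (suc i))
  (step : ∀ i → w (suc i) ≈[ len i ] w i) where

  len-mono : ∀ j i → len i ℕ.≤ len (j ℕ.+ i)
  len-mono zero i = ℕ.≤-refl
  len-mono (suc j) i = ℕ.≤-trans (len-mono j i) (grow (j ℕ.+ i))

  stable : ∀ j i → w (j ℕ.+ i) ≈[ len i ] w i
  stable zero i = ≈-refl
  stable (suc j) i = ≈-trans (≈-mono (len-mono j i) (step (j ℕ.+ i))) (stable j i)

  -- Entry `t` is settled from stage `t` on because `t < len t`. Stages `t` and `i` are compared at
  -- the common later stage `t + i`.
  diagonal-≈ : ∀ i → diagonal w ≈[ len i ] w i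
  diagonal-≈ i t t<len = trans (sym (stable i t t (long t)))
    (trans (cong (λ n → w n t) (ℕ.+-comm i t)) (stable t i t t<len))

-- Countable dense families of sequences.

module DenseSequence {A : Set a} (enum : ℕ → A) (surjective : ∀ v → ∃[ n ] enum n ≡ v) where

  -- A number codes an infinite sequence: repeated unpairing splits off one entry at a time, so
  -- every finite prefix is realised by some number.
  digits : ℕ → ℕ → A
  digits n zero = enum (proj₁ (unpair n))
  digits n (suc i) = digits (proj₂ (unpair n)) i

  digits-dense : ∀ k x → ∃[ n ] digits n ≈[ k ] x
  digits-dense zero x = 0 , λ i ()
  digits-dense (suc k) x with surjective (x 0) | digits-dense k (x ∘ suc)
  ... | h , enum-h | t , t-agrees = pair h t , agrees
    where
    agrees : digits (pair h t) ≈[ suc k ] x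
    agrees zero _ = trans (cong (enum ∘ proj₁) (unpair-pair h t)) enum-h
    agrees (suc i) (s≤s i<k) =
      trans (cong (λ p → digits (proj₂ p) i) (unpair-pair h t)) (t-agrees i i<k)

  dense : ℕ → ℕ → A
  dense n = digits (proj₂ (unpair n))

  -- The first component of the index is wasted so as to make the index large.
  dense-sequence : ∀ k x → ∃[ n ] k ℕ.≤ n × dense n ≈[ k ] x
  dense-sequence k x =
    let m , agrees = digits-dense k x
    in  pair k m , m≤pair k m
        , subst (λ p → digits (proj₂ p) ≈[ k ] x) (sym (unpair-pair k m)) agrees

isZero : ℕ → Bool
isZero zero = true
isZero (suc n) = false

isZero-surjective : ∀ v → ∃[ n ] isZero n ≡ v
isZero-surjective true = 0 , refl
isZero-surjective false = 1 , refl

isZero² : ℕ → Bool × Bool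
isZero² n = isZero (proj₁ (unpair n)) , isZero (proj₂ (unpair n))

isZero²-surjective : ∀ v → ∃[ n ] isZero² n ≡ v
isZero²-surjective (u , v) =
  let m , eq = isZero-surjective u
      n , eq′ = isZero-surjective v
  in  pair m n , trans (cong (λ p → isZero (proj₁ p) , isZero (proj₂ p)) (unpair-pair m n))
                       (cong₂ _,_ eq eq′)

module Cantor = DenseSequence isZero isZero-surjective
module Cantor² = DenseSequence isZero² isZero²-surjective

-- Rational bounds for cuts.

fromℚ : ℚ → ℝ
fromℚ q = record
  { cut       = ℚ._< q
  ; inhabited = q ℚ.- 1ℚ , subst (q ℚ.- 1ℚ ℚ.<_) (ℚ.+-identityʳ q)
                  (ℚ.+-monoʳ-< q (ℚ.negative⁻¹ (ℚ.- 1ℚ)))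
  ; proper    = q , ℚ.<-irrefl refl
  ; lower     = ℚ.<-trans
  ; open-up   = ℚ.<-dense
  }

∉⇒bound : ∀ x {p q} → p ∈ cut x → q ∉ cut x → p ℚ.< q
∉⇒bound x {p} {q} p∈x q∉x = ℚ.≰⇒> λ q≤p → case q ℚ.<? p of λ where
  (yes q<p) → q∉x (lower x q<p p∈x)
  (no q≮p) → q∉x (subst (_∈ cut x) (ℚ.≤-antisym (ℚ.≮⇒≥ q≮p) q≤p) p∈x)

-- Rationals outside a cut are its upper bounds, and upper bounds add. The triangle inequality is
-- always applied in this form.
+-bound : ∀ x y z {p q} → z ≤ x + y → p ∉ cut x → q ∉ cut y → p ℚ.+ q ∉ cut z
+-bound x y z z≤x+y p∉x q∉y p+q∈z =
  let r , t , r∈x , t∈y , eq = z≤x+y p+q∈z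
  in  ℚ.<-irrefl eq (ℚ.+-mono-< (∉⇒bound x r∈x p∉x) (∉⇒bound y t∈y q∉y))

0<fromℚ : ∀ {q} → 0ℚ ℚ.< q → 0ℝ < fromℚ q
0<fromℚ 0<q = 0ℚ , ℚ.<-irrefl refl , 0<q

p+[q-p]≡q : ∀ p q → p ℚ.+ (q ℚ.- p) ≡ q
p+[q-p]≡q p q = trans (cong (p ℚ.+_) (ℚ.+-comm q (ℚ.- p)))
  (trans (sym (ℚ.+-assoc p (ℚ.- p) q))
    (trans (cong (ℚ._+ q) (ℚ.+-inverseʳ p)) (ℚ.+-identityˡ q)))

half : ∀ {q} → 0ℚ ℚ.< q → ∃[ h ] 0ℚ ℚ.< h × h ℚ.+ h ≡ q
half {q} 0<q = h , ℚ.≰⇒> h≰0 , h+h≡q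
  where
  h = ℚ.½ ℚ.* q
  h+h≡q = trans (sym (ℚ.*-distribʳ-+ q ℚ.½ ℚ.½)) (ℚ.*-identityˡ q)

  h≰0 : ¬ (h ℚ.≤ 0ℚ)
  h≰0 h≤0 = ℚ.<-irrefl refl
    (ℚ.<-≤-trans 0<q (subst (ℚ._≤ 0ℚ) h+h≡q (ℚ.+-mono-≤ {h} {0ℚ} {h} {0ℚ} h≤0 h≤0)))

unitFraction : ℕ → ℚ
unitFraction k = mkℚ (ℤ.+ 1) k (1-coprimeTo (suc k))

unitFraction-≤ : ∀ {q} → 0ℚ ℚ.< q → ∃[ k ] unitFraction k ℚ.≤ q
unitFraction-≤ {q} 0<q = go q (ℚ.positive 0<q)
  where
  go : ∀ q → ℚ.Positive q → ∃[ k ] unitFraction k ℚ.≤ q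
  go (mkℚ ℤ.+[1+ n ] d _) _ = d , ℚ.*≤* (ℤ.*-monoʳ-≤-nonNeg (ℤ.+ suc d) {ℤ.+ 1} {ℤ.+[1+ n ]} (ℤ.+≤+ (s≤s z≤n)))

module Classical (em : ∀ ℓ → ExcludedMiddle ℓ) where

  -- Classical logic and the Baire category theorem.

  decide : (P : Set ℓ) → Dec P
  decide {ℓ} P = em ℓ

  by-contradiction : {P : Set ℓ} → ¬ ¬ P → P
  by-contradiction {P = P} = decidable-stable (decide P)

  ¬∀⇒∃¬ : {A : Set a} {P : A → Set ℓ} → ¬ (∀ x → P x) → ∃[ x ] ¬ P x
  ¬∀⇒∃¬ ¬all = by-contradiction λ ¬∃ → ¬all λ x → by-contradiction λ ¬Px → ¬∃ (x , ¬Px)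

  -- Baire category in ℕ → K, where (z , k) stands for the box of all
  -- sequences extending the first k values of z.

  DenseFamily : {K : Set a} → ((ℕ → K) → ℕ → Set) → Set a
  DenseFamily D = ∀ z k → ∃[ z′ ] ∃[ k′ ] k ℕ.≤ k′ × z′ ≈[ k ] z × D z′ k′

  Meets : {K : Set a} → ((ℕ → K) → ℕ → Set) → (ℕ → K) → Set a
  Meets D x = ∃[ z ] ∃[ k ] x ≈[ k ] z × D z k

  -- Step `i` shrinks the current box to a member of `D i`, after raising its length to at least
  -- `i + 1`. Thus entry `i` is final from then on and the diagonal lies in all the boxes.
  generic : {K : Set a} (D : ℕ → (ℕ → K) → ℕ → Set) → (∀ i → DenseFamily (D i)) →
            ∀ z k → ∃[ x ] x ≈[ k ] z × (∀ i → Meets (D i) x)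
  generic {K = K} D dense z k =
    diagonal w , ≈-mono (ℕ.m≤m⊔n k 1) (limit 0) , meets
    where
    stage : ℕ → (ℕ → K) × ℕ
    stage zero = z , k
    stage (suc i) =
      let x , l = stage i
          x′ , l′ , _ = dense i x (l ℕ.⊔ suc i)
      in  x′ , l′

    w : ℕ → ℕ → K
    w i = proj₁ (stage i)

    len : ℕ → ℕ
    len i = proj₂ (stage i) ℕ.⊔ suc i

    next-stage : ∀ i → len i ℕ.≤ proj₂ (stage (suc i)) ×
                 w (suc i) ≈[ len i ] w i × D i (w (suc i)) (proj₂ (stage (suc i)))
    next-stage i = let _ , _ , props = dense i (w i) (len i) in props

    limit : ∀ i → diagonal w ≈[ len i ] w i
    limit = diagonal-≈ w len (λ i → ℕ.m≤n⊔m (proj₂ (stage i)) (suc i))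
      (λ i → ℕ.≤-trans (proj₁ (next-stage i)) (ℕ.m≤m⊔n _ _))
      (λ i → proj₁ (proj₂ (next-stage i)))

    meets : ∀ i → Meets (D i) (diagonal w)
    meets i = w (suc i) , proj₂ (stage (suc i))
      , ≈-mono (ℕ.m≤m⊔n _ _) (limit (suc i)) , proj₂ (proj₂ (next-stage i))

  -- Meager sets.

  Meager : {K : Set a} → Pred (ℕ → K) ℓ → Set _
  Meager {K = K} M = Σ (ℕ → (ℕ → K) → ℕ → Set) λ D →
    (∀ i → DenseFamily (D i)) × (∀ z → z ∈ M → ¬ (∀ i → Meets (D i) z))

  module _ {K : Set a} where

    meager-⊆ : {M : Pred (ℕ → K) ℓ} {M′ : Pred (ℕ → K) ℓ′} →
               (∀ z → z ∈ M → z ∈ M′) → Meager M′ → Meager M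
    meager-⊆ sub (D , dense , avoids) = D , dense , λ z z∈M → avoids z (sub z z∈M)

    meager-empty : {M : Pred (ℕ → K) ℓ} → (∀ z → ¬ (z ∈ M)) → Meager M
    meager-empty empty = (λ _ _ _ → ⊤) , (λ _ z k → z , k , ℕ.≤-refl , ≈-refl , tt)
      , λ z z∈M → contradiction z∈M (empty z)

    meager-cover : {M : Pred (ℕ → K) ℓ} (P : ℕ → Pred (ℕ → K) ℓ′) →
                   (∀ n → Meager (P n)) → (∀ z → z ∈ M → ∃[ n ] z ∈ P n) → Meager M
    meager-cover P meager covers =
        (λ j → let n , i = unpair j in proj₁ (meager n) i)
      , (λ j → let n , i = unpair j in proj₁ (proj₂ (meager n)) i)
      , λ z z∈M meets →
          let n , z∈P = covers z z∈M
          in  proj₂ (proj₂ (meager n)) z z∈P λ i →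
                subst (λ p → Meets (proj₁ (meager (proj₁ p)) (proj₂ p)) z)
                      (unpair-pair n i) (meets (pair n i))

    infix 5 _↾_,_

    _↾_,_ : Pred (ℕ → K) ℓ → (ℕ → K) → ℕ → Pred (ℕ → K) _
    (M ↾ z , k) x = x ≈[ k ] z × x ∈ M

    module _ (q : ℕ → ℕ → K) (q-dense : ∀ k z → ∃[ n ] q n ≈[ k ] z) where

      -- This is Banach's category theorem for countably many boxes. The boxes with meager trace
      -- form a dense family `E`; what lies outside them is nowhere dense, and the rest is covered
      -- by the countably many boxes around the points `q j`.
      meager-locally : (M : Pred (ℕ → K) ℓ) (z : ℕ → K) (k : ℕ) →
        (∀ z′ k′ → k ℕ.≤ k′ → z′ ≈[ k ] z →
           ∃[ z″ ] ∃[ k″ ] k′ ℕ.≤ k″ × z″ ≈[ k′ ] z′ × Meager (M ↾ z″ , k″)) →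
        Meager (M ↾ z , k)
      meager-locally {ℓ = ℓ} M z k local = meager-cover piece piece-meager covers
        where
        N : Pred (ℕ → K) _
        N = M ↾ z , k

        E : (ℕ → K) → ℕ → Set
        -- The decision is wrapped in `True` since members of a dense family must be propositions of
        -- level 0.
        E z′ k′ = True (decide (Meager (N ↾ z′ , k′)))

        E-dense : DenseFamily E
        E-dense c l with decide (∃[ y ] y ≈[ l ] c × y ≈[ k ] z)
        ... | yes (y , y≈c , y≈z) =
          let z″ , k″ , k′≤k″ , z″≈y , meager =
                local y (k ℕ.⊔ l) (ℕ.m≤m⊔n k l) y≈z
          in  z″ , k″ , ℕ.≤-trans (ℕ.m≤n⊔m k l) k′≤k″
              , ≈-trans (≈-mono (ℕ.m≤n⊔m k l) z″≈y) y≈c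
              , fromWitness (meager-⊆ (λ { _ (e , _ , x∈M) → e , x∈M }) meager)
        ... | no disjoint = c , l , ℕ.≤-refl , ≈-refl
          , fromWitness (meager-empty λ { y (e , e′ , _) → disjoint (y , e , e′) })

        piece : ℕ → Pred (ℕ → K) _
        piece zero x = ¬ Meets E x × x ∈ N
        piece (suc n) x = let j , l = unpair n in
          True (decide (Meager (N ↾ q j , l))) × x ∈ (N ↾ q j , l)

        piece-meager : ∀ n → Meager (piece n)
        piece-meager zero = (λ _ → E) , (λ _ → E-dense) , λ { _ (¬meets , _) meets → ¬meets (meets 0) }
        piece-meager (suc n) with decide (Meager (N ↾ q (proj₁ (unpair n)) , proj₂ (unpair n)))
        ... | yes meager = meager-⊆ (λ _ → proj₂) meager
        ... | no ¬meager = meager-empty λ _ ()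

        covers : ∀ x → x ∈ N → ∃[ n ] x ∈ piece n
        covers x x∈N with decide (Meets E x)
        ... | no ¬meets = 0 , ¬meets , x∈N
        ... | yes (z″ , l , x≈z″ , meager) =
          let j , qj≈z″ = q-dense l z″
              meager′ = meager-⊆ (λ { _ (e , y∈N) → ≈-trans e qj≈z″ , y∈N }) (toWitness meager)
          in  suc (pair j l)
              , subst (λ p → True (decide (Meager (N ↾ q (proj₁ p) , proj₂ p))) × x ∈ (N ↾ q (proj₁ p) , proj₂ p))
                  (sym (unpair-pair j l))
                  (fromWitness meager′ , ≈-trans x≈z″ (≈-sym qj≈z″) , x∈N)

  -- Continuous maps from sequence spaces to Hausdorff spaces.

  Hausdorff : {X : Set a} → Topology X a o → Set _
  Hausdorff τ = ∀ x y → x ≢ y →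
    ∃[ V ] ∃[ W ] Open τ V × Open τ W × x ∈ V × y ∈ W × (∀ z → z ∈ V → ¬ (z ∈ W))

  SeqContinuous : {K : Set b} {X : Set a} → Topology X a o → ((ℕ → K) → X) → Set _
  SeqContinuous τ F = ∀ V → Open τ V → ∀ x → F x ∈ V → ∃[ n ] (∀ y → x ≈[ n ] y → F y ∈ V)

  module _ {X : Set a} (τ : Topology X a o) (hausdorff : Hausdorff τ) where

    -- If the limits differed, disjoint neighbourhoods of them would share the common value at a
    -- late `k`.
    limits-coincide : {K : Set b} {L : Set ℓ} {F : (ℕ → K) → X} {G : (ℕ → L) → X} →
      SeqContinuous τ F → SeqContinuous τ G →
      ∀ x y (xs : ℕ → ℕ → K) (ys : ℕ → ℕ → L) →
      (∀ k → x ≈[ k ] xs k) → (∀ k → y ≈[ k ] ys k) →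
      (∀ k → F (xs k) ≡ G (ys k)) → F x ≡ G y
    limits-coincide {F = F} {G} F-cont G-cont x y xs ys x-lim y-lim eq =
      by-contradiction λ Fx≢Gy →
        let V , W , oV , oW , Fx∈V , Gy∈W , disjoint = hausdorff (F x) (G y) Fx≢Gy
            m , F-near = F-cont V oV x Fx∈V
            n , G-near = G-cont W oW y Gy∈W
            k = m ℕ.⊔ n
        in  disjoint (F (xs k)) (F-near (xs k) (≈-mono (ℕ.m≤m⊔n m n) (x-lim k)))
              (subst W (sym (eq k)) (G-near (ys k) (≈-mono (ℕ.m≤n⊔m m n) (y-lim k))))

    -- Without function extensionality, pointwise equal sequences are identified only after applying
    -- a continuous map.
    continuous-resp : {K : Set b} {F : (ℕ → K) → X} → SeqContinuous τ F →
                      ∀ x y → (∀ i → x i ≡ y i) → F x ≡ F y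
    continuous-resp F-cont x y x≗y = limits-coincide F-cont F-cont x y (λ _ → y) (λ _ → y)
      (λ _ i _ → x≗y i) (λ _ → ≈-refl) (λ _ → refl)

  -- Analytic relations and the σ-ideal of colorable sets.

  record AnalyticRelation {X : Set a} (τ : Topology X a o) (R : X → X → Set ℓ) : Set (Level.suc a ⊔ o ⊔ ℓ) where
    field
      code       : Bool → (ℕ → ℕ) → X
      continuous : ∀ b → SeqContinuous τ (code b)
      sound      : ∀ α → R (code false α) (code true α)
      complete   : ∀ {x y} → R x y → ∃[ α ] code false α ≡ x × code true α ≡ y

  Colorable : {X : Set a} → (X → X → Set ℓ) → Pred X ℓ′ → Set _
  Colorable {X = X} R M = Σ (X → ℕ) λ c → ∀ x y → x ∈ M → y ∈ M → c x ≡ c y → ¬ R x y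

  module _ {X : Set a} {R : X → X → Set ℓ} where

    colorable-⊆ : {M : Pred X ℓ′} {M′ : Pred X b} →
                  (∀ x → x ∈ M → x ∈ M′) → Colorable R M′ → Colorable R M
    colorable-⊆ sub (c , proper) = c , λ x y x∈M y∈M → proper x y (sub x x∈M) (sub y y∈M)

    -- A point is colored by the index of a piece containing it together with its color there, so
    -- points of equal color lie in one piece.
    colorable-cover : (P : ℕ → Pred X ℓ′) → (∀ n → Colorable R (P n)) →
                      Colorable R (λ x → ∃[ n ] x ∈ P n)
    colorable-cover P colorable = color , λ x y → proper
      where
      index : ∀ x → Dec (∃[ n ] x ∈ P n) → ℕ
      index x (yes (n , _)) = n
      index x (no _) = 0

      index-∈ : ∀ x (p? : Dec (∃[ n ] x ∈ P n)) → (∃[ n ] x ∈ P n) → x ∈ P (index x p?)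
      index-∈ x (yes (_ , x∈P)) _ = x∈P
      index-∈ x (no ∉P) p = contradiction p ∉P

      idx : X → ℕ
      idx x = index x (decide _)

      color : X → ℕ
      color x = pair (idx x) (proj₁ (colorable (idx x)) x)

      proper : ∀ {x y} → (∃[ n ] x ∈ P n) → (∃[ n ] y ∈ P n) → color x ≡ color y → ¬ R x y
      proper {x} {y} p q eq =
        proj₂ (colorable (idx x)) x y (index-∈ x (decide _) p)
          (subst (λ n → y ∈ P n) (sym idx≡) (index-∈ y (decide _) q))
          (trans (cong proj₂ eqs) (cong (λ n → proj₁ (colorable n) y) (sym idx≡)))
        where
        eqs = pair-injective eq
        idx≡ = cong proj₁ eqs

    colorable-∪ : {P Q : Pred X ℓ′} → Colorable R P → Colorable R Q →
                  Colorable R (λ x → x ∈ P ⊎ x ∈ Q)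
    colorable-∪ {P = P} {Q} P-col Q-col = colorable-⊆ covers (colorable-cover piece piece-col)
      where
      piece : ℕ → Pred X _
      piece zero = P
      piece (suc _) = Q

      piece-col : ∀ n → Colorable R (piece n)
      piece-col zero = P-col
      piece-col (suc _) = Q-col

      covers : ∀ x → x ∈ P ⊎ x ∈ Q → ∃[ n ] x ∈ piece n
      covers x (inj₁ x∈P) = 0 , x∈P
      covers x (inj₂ x∈Q) = 1 , x∈Q

    independent-colorable : {M : Pred X ℓ′} → (∀ x y → x ∈ M → y ∈ M → ¬ R x y) → Colorable R M
    independent-colorable ind = (λ _ → 0) , λ x y x∈M y∈M _ → ind x y x∈M y∈M

  -- Homomorphisms from the graph G₀.

  G₀Homomorphism : {X : Set a} → (ℕ → ℕ → Bool) → (X → X → Set ℓ) → ((ℕ → Bool) → X) → Set _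
  G₀Homomorphism S R φ = ∀ n x y → x ≈[ n ] S n → x n ≡ false → y n ≡ true →
    (∀ i → i ≢ n → x i ≡ y i) → R (φ x) (φ y)

  -- The nontrivial half of the G₀ dichotomy of Kechris, Solecki and
  -- Todorcevic.
  module G₀ (S : ℕ → ℕ → Bool) {X : Set a} (τ : Topology X a o) (hausdorff : Hausdorff τ)
    {R : X → X → Set ℓ} (analytic : AnalyticRelation τ R)
    (uncolorable : ¬ Colorable {ℓ′ = 0ℓ} R (λ _ → ⊤)) where

    open AnalyticRelation analytic

    -- A configuration labels the binary strings of length n by points and the
    -- edges of G₀ between them by witnesses of R.  The last bit of a string is
    -- read first.
    Config : ℕ → Set a
    point : ∀ n → Config n → (ℕ → Bool) → X

    Config zero = X
    Config (suc n) = Σ (Bool → Config n) λ γ → Σ (ℕ → ℕ) λ w →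
      ∀ b → code b w ≡ point n (γ b) (S n)

    point zero x _ = x
    point (suc n) (γ , _) x = point n (γ (x n)) x

    witness : ∀ {n} → Config (suc n) → ℕ → ℕ
    witness (_ , w , _) = w

    -- Only the witnesses are approximated, not the points: they determine the
    -- points in the limit, and natural numbers suffice as approximations.
    approx : ℕ → ∀ n → Config n → ℕ
    approx m zero _ = 0
    approx m (suc n) (γ , w , _) =
      pair (prefixCode m w) (pair (approx m n (γ false)) (approx m n (γ true)))

    approx-witness : ∀ m n γ γ′ → approx m (suc n) γ ≡ approx m (suc n) γ′ →
                     witness γ ≈[ m ] witness γ′
    approx-witness m n (_ , w , _) (_ , w′ , _) eq =
      prefixCode-injective m (cong proj₁ (pair-injective eq))

    approx-child : ∀ m n γ γ′ → approx m (suc n) γ ≡ approx m (suc n) γ′ →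
                   ∀ b → approx m n (proj₁ γ b) ≡ approx m n (proj₁ γ′ b)
    approx-child m n (γ , w , _) (γ′ , w′ , _) eq = λ where
        false → cong proj₁ eqs
        true → cong proj₂ eqs
      where
      eqs = pair-injective (cong proj₂ (pair-injective eq))

    Avoids : ∀ n → Config n → Pred X a → Set a
    Avoids n γ M = ∀ x → ¬ (point n γ x ∈ M)

    Positive : ∀ n → Pred (Config n) 0ℓ → Set _
    Positive n A = ∀ (M : Pred X a) → Colorable R M → ∃[ γ ] γ ∈ A × Avoids n γ M

    -- Here uncolorability enters: a colorable set met by every one-point configuration would be all
    -- of `X`.
    all-positive : Positive 0 (λ _ → ⊤)
    all-positive M M-col = by-contradiction λ none → uncolorable
      (colorable-⊆ (λ x _ → by-contradiction λ x∉M → none (x , tt , λ _ → x∉M)) M-col)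

    Extension : ∀ n → Pred (Config n) 0ℓ → ℕ → Pred (Config (suc n)) 0ℓ
    Extension n A c γ = (∀ b → proj₁ γ b ∈ A) × approx (suc n) (suc n) γ ≡ c

    -- If every extension of A were to miss some colorable set, then the values
    -- at S n of the configurations in A avoiding all of these sets would form
    -- an R-independent set.
    extend : ∀ n A → Positive n A → ∃[ c ] Positive (suc n) (Extension n A c)
    extend n A positive = by-contradiction λ none →
      let missed : ∀ c → ∃[ M ] Colorable R M × ¬ (∃[ γ ] γ ∈ Extension n A c × Avoids (suc n) γ M)
          missed c = let M , ¬meets = ¬∀⇒∃¬ (λ pos → none (c , pos))
                     in  M , ¬∀⇒∃¬ ¬meets
          M : Pred X a
          M x = ∃[ c ] x ∈ proj₁ (missed c)
          M-col : Colorable R M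
          M-col = colorable-cover (λ c → proj₁ (missed c)) (λ c → proj₁ (proj₂ (missed c)))
          B : Pred X a
          B x = ∃[ γ ] γ ∈ A × Avoids n γ M × point n γ (S n) ≡ x
          independent : ∀ x y → x ∈ B → y ∈ B → ¬ R x y
          independent x y (γ₀ , γ₀∈A , avoids₀ , eq₀) (γ₁ , γ₁∈A , avoids₁ , eq₁) Rxy =
            let w , w₀ , w₁ = complete Rxy
                γ : Config (suc n)
                γ = (λ b → if b then γ₁ else γ₀) , w
                    , λ { false → trans w₀ (sym eq₀) ; true → trans w₁ (sym eq₁) }
                c = approx (suc n) (suc n) γ
                -- `c` is the code of the extension just built, so `missed c` applies to it, while
                -- its vertices avoid `M`, which contains the set missed for `c`.
                avoids : ∀ b x → ¬ (point n (if b then γ₁ else γ₀) x ∈ M)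
                avoids = λ { false → avoids₀ ; true → avoids₁ }
            in  proj₂ (proj₂ (missed c))
                  (γ , ((λ { false → γ₀∈A ; true → γ₁∈A }) , refl) , λ x x∈M → avoids (x n) x (c , x∈M))
          -- A configuration avoiding both `M` and `B` has its own value at `S n` in `B`, a
          -- contradiction.
          γ , γ∈A , avoids = positive (λ x → x ∈ M ⊎ x ∈ B)
            (colorable-∪ M-col (independent-colorable independent))
      in  avoids (S n) (inj₂ (γ , γ∈A , (λ x x∈M → avoids x (inj₁ x∈M)) , refl))

    positiveSet : ∀ n → Σ (Pred (Config n) 0ℓ) (Positive n)
    positiveSet zero = (λ _ → ⊤) , all-positive
    positiveSet (suc n) =
      let A , positive = positiveSet n
          c , positive′ = extend n A positive
      in  Extension n A c , positive′

    𝒜 : ∀ n → Pred (Config n) 0ℓ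
    𝒜 n = proj₁ (positiveSet n)

    -- Each extension step prescribes the code, so any two members of `𝒜 n` are interchangeable up
    -- to precision `n`.
    approx-constant : ∀ n γ γ′ → γ ∈ 𝒜 n → γ′ ∈ 𝒜 n → approx n n γ ≡ approx n n γ′
    approx-constant zero _ _ _ _ = refl
    approx-constant (suc n) γ γ′ (_ , eq) (_ , eq′) = trans eq (sym eq′)

    chosen : ∀ n → ∃[ γ ] γ ∈ 𝒜 n
    chosen n =
      let γ , γ∈A , _ = proj₂ (positiveSet n) (λ _ → Lift a ⊥) (independent-colorable λ _ _ ())
      in  γ , γ∈A

    -- The bits of `x` at positions `k + n - 1` down to `n` select one of the copies inside the
    -- configuration.
    sub : ∀ k {n} → Config (k ℕ.+ n) → (ℕ → Bool) → Config n
    sub zero γ x = γ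
    sub (suc k) {n} (γ , _) x = sub k (γ (x (k ℕ.+ n))) x

    point-sub : ∀ k n γ x → point (k ℕ.+ n) γ x ≡ point n (sub k γ x) x
    point-sub zero n γ x = refl
    point-sub (suc k) n (γ , _) x = point-sub k n (γ (x (k ℕ.+ n))) x

    point-cong : ∀ n γ x y → x ≈[ n ] y → point n γ x ≡ point n γ y
    point-cong zero γ x y e = refl
    point-cong (suc n) (γ , _) x y e =
      trans (cong (λ b → point n (γ b) x) (e n ℕ.≤-refl))
            (point-cong n (γ (y n)) x y (≈-mono (ℕ.n≤1+n n) e))

    sub-cong : ∀ k n γ x y → (∀ i → n ℕ.≤ i → i ℕ.< k ℕ.+ n → x i ≡ y i) →
               sub k {n} γ x ≡ sub k γ y
    sub-cong zero n γ x y e = refl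
    sub-cong (suc k) n (γ , _) x y e =
      trans (cong (λ b → sub k (γ b) x) (e (k ℕ.+ n) (ℕ.m≤n+m n k) ℕ.≤-refl))
            (sub-cong k n (γ (y (k ℕ.+ n))) x y λ i n≤i i<k+n → e i n≤i (ℕ.m≤n⇒m≤1+n i<k+n))

    sub-approx : ∀ m k n γ γ′ x → approx m (k ℕ.+ n) γ ≡ approx m (k ℕ.+ n) γ′ →
                 approx m n (sub k γ x) ≡ approx m n (sub k γ′ x)
    sub-approx m zero n γ γ′ x eq = eq
    sub-approx m (suc k) n γ γ′ x eq =
      sub-approx m k n (proj₁ γ _) (proj₁ γ′ _) x (approx-child m (k ℕ.+ n) γ γ′ eq (x (k ℕ.+ n)))

    edgeWitness : ∀ n → (ℕ → Bool) → ℕ → ℕ → ℕ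
    edgeWitness n x k = witness (sub k {suc n} (proj₁ (chosen (k ℕ.+ suc n))) x)

    -- The half of `chosen (suc m)` selected by `x m` belongs to `𝒜 m`, hence has the same
    -- approximation of precision `m` as `chosen m`; and `m` is at least `k + 1`.
    edgeWitness-stable : ∀ n x k → edgeWitness n x (suc k) ≈[ suc k ] edgeWitness n x k
    edgeWitness-stable n x k = ≈-mono sk≤m
      (approx-witness m n (sub k γ′ x) (sub k γ x)
        (sub-approx m k (suc n) γ′ γ x (approx-constant m γ′ γ γ′∈A (proj₂ (chosen m)))))
      where
      m = k ℕ.+ suc n
      γ = proj₁ (chosen m)
      γ′ = proj₁ (proj₁ (chosen (suc m))) (x m)
      γ′∈A = proj₁ (proj₂ (chosen (suc m))) (x m)
      sk≤m : suc k ℕ.≤ m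
      sk≤m = subst (suc k ℕ.≤_) (sym (ℕ.+-suc k n)) (s≤s (ℕ.m≤m+n k n))

    edgeLimit : ∀ n → (ℕ → Bool) → ℕ → ℕ
    edgeLimit n x = diagonal (edgeWitness n x)

    edgeLimit-≈ : ∀ n x k → edgeLimit n x ≈[ suc k ] edgeWitness n x k
    edgeLimit-≈ n x = diagonal-≈ (edgeWitness n x) suc (λ _ → ℕ.≤-refl) (λ _ → ℕ.n≤1+n _)
      (edgeWitness-stable n x)

    edgeWitness-point : ∀ n x k → x ≈[ n ] S n →
      code (x n) (edgeWitness n x k) ≡ point (k ℕ.+ suc n) (proj₁ (chosen (k ℕ.+ suc n))) x
    edgeWitness-point n x k e =
      trans (proj₂ (proj₂ η) (x n))
        (sym (trans (point-sub k (suc n) γ x) (point-cong n (proj₁ η (x n)) x (S n) e)))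
      where
      γ = proj₁ (chosen (k ℕ.+ suc n))
      η = sub k {suc n} γ x

    -- The string `S 0` is read to length 0, so every `x` is an endpoint of an edge of index 0, on
    -- the side given by `x 0`.
    φ : (ℕ → Bool) → X
    φ x = code (x 0) (edgeLimit 0 x)

    -- Both sides are limits of the same points: at finite levels, the witness of edge 0 at step
    -- `k + n` and that of edge `n` at step `k` come from one configuration and decode to its label
    -- at `x`.
    φ-edge : ∀ n x → x ≈[ n ] S n → φ x ≡ code (x n) (edgeLimit n x)
    φ-edge n x e = limits-coincide τ hausdorff (continuous (x 0)) (continuous (x n)) _ _
      (λ k → edgeWitness 0 x (k ℕ.+ n)) (edgeWitness n x)
      (λ k → ≈-mono (ℕ.≤-trans (ℕ.m≤m+n k n) (ℕ.n≤1+n _)) (edgeLimit-≈ 0 x (k ℕ.+ n)))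
      (λ k → ≈-mono (ℕ.n≤1+n k) (edgeLimit-≈ n x k))
      λ k → trans (edgeWitness-point 0 x (k ℕ.+ n) λ _ ())
        (trans (cong (λ m → point m (proj₁ (chosen m)) x) (same-level k))
               (sym (edgeWitness-point n x k e)))
      where
      same-level : ∀ k → k ℕ.+ n ℕ.+ 1 ≡ k ℕ.+ suc n
      same-level k = trans (ℕ.+-assoc k n 1) (cong (k ℕ.+_) (ℕ.+-comm n 1))

    φ-continuous : SeqContinuous τ φ
    φ-continuous V oV x φx∈V =
      let n , near = continuous (x 0) V oV (edgeLimit 0 x) φx∈V
      -- Entry `i` of `edgeLimit 0` reads only bits up to `i`; the extra bit secures `x 0`, which
      -- picks the side, even when `n` is 0.
      in  suc n , λ y x≈y →
        subst (λ b → code b (edgeLimit 0 y) ∈ V) (x≈y 0 (s≤s z≤n))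
          (near (edgeLimit 0 y) λ i i<n → cong (λ η → witness η i)
            (sub-cong i 1 (proj₁ (chosen (i ℕ.+ 1))) x y λ j _ j<i+1 →
              x≈y j (ℕ.≤-trans j<i+1
                (ℕ.≤-trans (ℕ.≤-reflexive (ℕ.+-comm i 1)) (ℕ.m≤n⇒m≤1+n i<n)))))

    -- `edgeLimit n` reads only bits beyond `n`, where `x` and `y` agree. So both endpoints are
    -- decoded from a single witness of `R`.
    φ-homomorphism : G₀Homomorphism S R φ
    φ-homomorphism n x y x≈S x≡false y≡true x≈y =
      subst₂ R
        (sym (trans (φ-edge n x x≈S) (cong (λ b → code b (edgeLimit n x)) x≡false)))
        (sym (trans (φ-edge n y y≈S) (trans (cong (λ b → code b (edgeLimit n y)) y≡true)
          (continuous-resp τ hausdorff (continuous true) _ _ λ i → sym (same-limit i)))))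
        (sound (edgeLimit n x))
      where
      y≈S : y ≈[ n ] S n
      y≈S i i<n = trans (sym (x≈y i (ℕ.<⇒≢ i<n))) (x≈S i i<n)

      same-limit : ∀ i → edgeLimit n x i ≡ edgeLimit n y i
      same-limit i = cong (λ η → witness η i)
        (sub-cong i (suc n) (proj₁ (chosen (i ℕ.+ suc n))) x y λ j n<j _ →
          x≈y j (ℕ.>⇒≢ n<j))

  -- Changing one bit of the first coordinate.

  both : (ℕ → Bool) → (ℕ → Bool) → ℕ → Bool × Bool
  both x y i = x i , y i

  setFst : ℕ → Bool → (ℕ → Bool × Bool) → ℕ → Bool × Bool
  setFst n b z = both (proj₁ ∘ z [ n ]≔ b) (proj₂ ∘ z)

  setFst-cong : ∀ n b {y z k} → y ≈[ k ] z → setFst n b y ≈[ k ] setFst n b z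
  setFst-cong n b e i i<k with i ℕ.≟ n
  ... | yes _ = cong (b ,_) (cong proj₂ (e i i<k))
  ... | no _ = e i i<k

  setFst-collapse : ∀ n b c z i → setFst n b (setFst n c z) i ≡ setFst n b z i
  setFst-collapse n b c z i with i ℕ.≟ n
  ... | yes _ = refl
  ... | no i≢n = cong (_, proj₂ (z i)) (unchanged (proj₁ ∘ z) i≢n)

  setFst-id : ∀ n z i → setFst n (proj₁ (z n)) z i ≡ z i
  setFst-id n z i with i ℕ.≟ n
  ... | yes refl = refl
  ... | no _ = refl

  -- The preimage under `setFst n b` of the open set described by `D`.
  Flip : ℕ → Bool → ((ℕ → Bool × Bool) → ℕ → Set) → (ℕ → Bool × Bool) → ℕ → Set
  Flip n b D z k = ∃[ x ] x ≈[ k ] setFst n b z × D x k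

  flip-dense : ∀ n b {D} → DenseFamily D → DenseFamily (Flip n b D)
  flip-dense n b dense z k =
    -- Refining beyond position `n` keeps bit `n` equal to `b`, so that restoring the old bit leads
    -- back into the given box.
    let k₁ = k ℕ.⊔ suc n
        x , l , k₁≤l , x≈ , x∈D = dense (setFst n b z) k₁
        z′ = setFst n (proj₁ (z n)) x
        xn≡b = trans (cong proj₁ (x≈ n (ℕ.m≤n⊔m k (suc n)))) (updated (proj₁ ∘ z) n b)
    in  z′ , l , ℕ.≤-trans (ℕ.m≤m⊔n k (suc n)) k₁≤l
        , (λ i i<k → trans (setFst-cong n _ x≈ i (ℕ.≤-trans i<k (ℕ.m≤m⊔n k (suc n))))
            (trans (setFst-collapse n _ b z i) (setFst-id n z i)))
        , x
        , (λ i _ → sym (trans (setFst-collapse n b _ x i)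
            (trans (cong (λ c → setFst n c x i) (sym xn≡b)) (setFst-id n x i))))
        , x∈D

  meets-flip : ∀ n b {D y} → Meets (Flip n b D) y → Meets D (setFst n b y)
  meets-flip n b (z , k , y≈z , x , x≈ , x∈D) =
    x , k , ≈-trans (setFst-cong n b y≈z) (≈-sym x≈) , x∈D

  -- Lengthening codes for the second relation.

  module Clique {X : Set a} (τ : Topology X a o) (hausdorff : Hausdorff τ)
    {R : X → X → Set ℓ} {R′ : X → X → Set ℓ′} (analytic : AnalyticRelation τ R′)
    (splits : ∀ u v → R u v → ∀ w → R′ u w ⊎ R′ v w)
    (φ : (ℕ → Bool) → X) (φ-continuous : SeqContinuous τ φ)
    (φ-homomorphism : G₀Homomorphism Cantor.dense R φ) where

    open AnalyticRelation analytic

    -- The part of the preimage of `R′` under `φ × φ` having a witness that starts with the first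
    -- `m` values of `α`.
    Coded : (ℕ → ℕ) → ℕ → Pred (ℕ → Bool × Bool) a
    Coded α m z = ∃[ β ] α ≈[ m ] β × code false β ≡ φ (proj₁ ∘ z) × code true β ≡ φ (proj₂ ∘ z)

    -- Largeness in every subbox, rather than just in the box, is what allows a
    -- code to be lengthened after the box has been shrunk for other pairs.
    Thick : (ℕ → ℕ) → ℕ → (ℕ → Bool × Bool) → ℕ → Set _
    Thick α m z k = ∀ z′ k′ → k ℕ.≤ k′ → z′ ≈[ k ] z → ¬ Meager (Coded α m ↾ z′ , k′)

    thick-≤ : ∀ {α m z k z′ k′} → k ℕ.≤ k′ → z′ ≈[ k ] z → Thick α m z k → Thick α m z′ k′
    thick-≤ k≤k′ z′≈z thick z″ k″ k′≤k″ z″≈z′ =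
      thick z″ k″ (ℕ.≤-trans k≤k′ k′≤k″) (≈-trans (≈-mono k≤k′ z″≈z′) z′≈z)

    thick-shorten : ∀ {α m n z k} → m ℕ.≤ n → Thick α n z k → Thick α m z k
    thick-shorten m≤n thick z′ k′ k≤k′ z′≈z meager = thick z′ k′ k≤k′ z′≈z
      (meager-⊆ (λ { _ (e , β , α≈β , eqs) → e , β , ≈-mono m≤n α≈β , eqs }) meager)

    -- A point generic for a given family, with first coordinate changed to be
    -- either end of an edge of G₀, stays generic; by splits, one of the ends is
    -- R′-related to the second coordinate.
    thick-0 : ∀ α z k → Thick α 0 z k
    thick-0 α _ _ z k _ _ (D , D-dense , avoids) = absurd (splits _ _ edge (φ (proj₂ ∘ y)))
      where
      -- The string `Cantor.dense n` of length `n ≥ k` begins like the first coordinate of `z`, so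
      -- changing bit `n` stays inside the box.
      anchor = Cantor.dense-sequence k (proj₁ ∘ z)
      n = proj₁ anchor
      k≤n = proj₁ (proj₂ anchor)
      z₀ = both (Cantor.dense n) (proj₂ ∘ z)

      D′ : ℕ → (ℕ → Bool × Bool) → ℕ → Set
      -- The index `j` codes a family together with a bit, as both ends of the edge must be generic
      -- for every family.
      D′ j = Flip n (isZero (proj₂ (unpair j))) (D (proj₁ (unpair j)))

      point = generic D′ (λ j → flip-dense n _ (D-dense _)) z₀ n
      y = proj₁ point
      y≈z₀ = proj₁ (proj₂ point)

      meets : ∀ b i → Meets (D i) (setFst n b y)
      meets b i =
        let c , c-eq = isZero-surjective b
            j = pair i c
        in  meets-flip n b
              (subst (λ c → Meets (Flip n c (D i)) y) c-eq
                (subst (λ p → Meets (Flip n (isZero (proj₂ p)) (D (proj₁ p))) y)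
                  (unpair-pair i c) (proj₂ (proj₂ point) j)))

      near : ∀ b → setFst n b y ≈[ k ] z
      near b i i<k =
        trans (cong (_, proj₂ (y i)) (unchanged (proj₁ ∘ y) (ℕ.<⇒≢ (ℕ.<-≤-trans i<k k≤n))))
          (trans (y≈z₀ i (ℕ.<-≤-trans i<k k≤n))
            (cong (_, proj₂ (z i)) (proj₂ (proj₂ anchor) i i<k)))

      end : Bool → ℕ → Bool
      end b = proj₁ ∘ setFst n b y

      edge : R (φ (end false)) (φ (end true))
      edge = φ-homomorphism n (end false) (end true)
        (≈-trans (updated-≈ (proj₁ ∘ y) n false) (≈-map proj₁ y≈z₀))
        (updated (proj₁ ∘ y) n false) (updated (proj₁ ∘ y) n true)
        λ i i≢n → trans (unchanged (proj₁ ∘ y) i≢n) (sym (unchanged (proj₁ ∘ y) i≢n))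

      related : ∀ b → ¬ R′ (φ (end b)) (φ (proj₂ ∘ y))
      related b r =
        let β , eq₀ , eq₁ = complete r
        in  avoids (setFst n b y) (near b , β , (λ _ ()) , eq₀ , eq₁) (meets b)

      absurd : R′ (φ (end false)) (φ (proj₂ ∘ y)) ⊎ R′ (φ (end true)) (φ (proj₂ ∘ y)) → ⊥
      absurd (inj₁ r) = related false r
      absurd (inj₂ r) = related true r

    -- The coded set is the union over all values `j` of the next entry. If no value became thick in
    -- any subbox, `meager-locally` would make every piece meager, and so the union.
    thick-refine₁ : ∀ α m z k → Thick α m z k →
      ∃[ α′ ] ∃[ z′ ] ∃[ k′ ] α ≈[ m ] α′ × k ℕ.≤ k′ × z′ ≈[ k ] z × Thick α′ (suc m) z′ k′
    thick-refine₁ α m z k thick = by-contradiction λ none →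
      thick z k ℕ.≤-refl ≈-refl (meager-cover
        (λ j → Coded (α [ m ]≔ j) (suc m) ↾ z , k)
        (λ j → meager-locally Cantor².digits Cantor².digits-dense _ z k λ z′ k′ k≤k′ z′≈z →
          by-contradiction λ ¬meager → none (α [ m ]≔ j , z′ , k′
            , ≈-sym (updated-≈ α m j) , k≤k′ , z′≈z
            , λ z″ k″ k′≤k″ z″≈z′ meager → ¬meager (z″ , k″ , k′≤k″ , z″≈z′ , meager)))
        λ { y (e , β , α≈β , eqs) → β m , e , β , ≈-sym (≈-extend (≈-sym α≈β)) , eqs })

    thick-refine : ∀ j α m z k → Thick α m z k →
      ∃[ α′ ] ∃[ z′ ] ∃[ k′ ] α ≈[ m ] α′ × k ℕ.≤ k′ × z′ ≈[ k ] z × Thick α′ (j ℕ.+ m) z′ k′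
    thick-refine zero α m z k thick = α , z , k , ≈-refl , ℕ.≤-refl , ≈-refl , thick
    thick-refine (suc j) α m z k thick =
      let α₁ , z₁ , k₁ , α≈α₁ , k≤k₁ , z₁≈z , thick₁ = thick-refine j α m z k thick
          α₂ , z₂ , k₂ , α₁≈α₂ , k₁≤k₂ , z₂≈z₁ , thick₂ = thick-refine₁ α₁ (j ℕ.+ m) z₁ k₁ thick₁
      in  α₂ , z₂ , k₂ , ≈-trans α≈α₁ (≈-mono (ℕ.m≤n+m m j) α₁≈α₂) , ℕ.≤-trans k≤k₁ k₁≤k₂
          , ≈-trans (≈-mono k≤k₁ z₂≈z₁) z₁≈z , thick₂

    module _ {U : Set} (s : U → ℕ → Bool) (k : ℕ) (σ : U → U → ℕ → ℕ) (m : U → U → ℕ)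
      (thick : ∀ u v → u ≢ v → Thick (σ u v) (m u v) (both (s u) (s v)) k) (M : ℕ) where

      Refined : U → U → (U → ℕ → Bool) → ℕ → Set _
      Refined u v s′ k′ = ∃[ α ] σ u v ≈[ m u v ] α × Thick α M (both (s′ u) (s′ v)) k′

      -- Pairs are treated one by one; shrinking boxes for a new pair spoils nothing, since
      -- thickness passes to subboxes.
      thick-refine-all : ∀ (L : List (U × U)) →
        ∃[ s′ ] ∃[ k′ ] k ℕ.≤ k′ × (∀ u → s′ u ≈[ k ] s u) ×
          (∀ u v → (u , v) ∈ˡ L → u ≢ v → Refined u v s′ k′)
      thick-refine-all [] = s , k , ℕ.≤-refl , (λ _ → ≈-refl) , λ _ _ ()
      thick-refine-all ((u₀ , v₀) ∷ L) with decide (u₀ ≡ v₀) | thick-refine-all L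
      ... | yes u₀≡v₀ | s₁ , k₁ , k≤k₁ , s₁≈s , refined =
        s₁ , k₁ , k≤k₁ , s₁≈s , λ where
          u v (here refl) u≢v → contradiction u₀≡v₀ u≢v
          u v (there uv∈L) u≢v → refined u v uv∈L u≢v
      ... | no u₀≢v₀ | s₁ , k₁ , k≤k₁ , s₁≈s , refined =
        s₂ , k₂ , ℕ.≤-trans k≤k₁ k₁≤k₂ , (λ u → ≈-trans (≈-mono k≤k₁ (s₂≈s₁ u)) (s₁≈s u)) , λ where
          u v (here refl) _ → α , α≈ , thick-≤ ℕ.≤-refl (λ i _ → cong₂ _,_ (s₂-u₀ i) (s₂-v₀ i))
            (thick-shorten (ℕ.m≤m+n M (m u₀ v₀)) thick₂)
          u v (there uv∈L) u≢v →
            let α , α≈ , thick = refined u v uv∈L u≢v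
            in  α , α≈ , thick-≤ k₁≤k₂ (λ i i<k₁ → cong₂ _,_ (s₂≈s₁ u i i<k₁) (s₂≈s₁ v i i<k₁)) thick
        where
        -- Adding `M` entries yields length `M + m u₀ v₀`, later cut back to `M`; this avoids a
        -- subtraction.
        refinement = thick-refine M (σ u₀ v₀) (m u₀ v₀) (both (s₁ u₀) (s₁ v₀)) k₁
          (thick-≤ k≤k₁ (λ i i<k → cong₂ _,_ (s₁≈s u₀ i i<k) (s₁≈s v₀ i i<k)) (thick u₀ v₀ u₀≢v₀))
        α = proj₁ refinement
        z = proj₁ (proj₂ refinement)
        k₂ = proj₁ (proj₂ (proj₂ refinement))
        props = proj₂ (proj₂ (proj₂ refinement))
        α≈ = proj₁ props
        k₁≤k₂ = proj₁ (proj₂ props)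
        z≈ = proj₁ (proj₂ (proj₂ props))
        thick₂ = proj₂ (proj₂ (proj₂ props))

        choose : ∀ u → Dec (u ≡ u₀) → Dec (u ≡ v₀) → ℕ → Bool
        choose u (yes _) _ = proj₁ ∘ z
        choose u (no _) (yes _) = proj₂ ∘ z
        choose u (no _) (no _) = s₁ u

        s₂ : U → ℕ → Bool
        s₂ u = choose u (decide _) (decide _)

        s₂-u₀ : ∀ i → s₂ u₀ i ≡ proj₁ (z i)
        s₂-u₀ i with decide (u₀ ≡ u₀)
        ... | yes _ = refl
        ... | no u₀≢u₀ = contradiction refl u₀≢u₀

        s₂-v₀ : ∀ i → s₂ v₀ i ≡ proj₂ (z i)
        s₂-v₀ i with decide (v₀ ≡ u₀) | decide (v₀ ≡ v₀)
        ... | yes v₀≡u₀ | _ = contradiction (sym v₀≡u₀) u₀≢v₀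
        ... | no _ | yes _ = refl
        ... | no _ | no v₀≢v₀ = contradiction refl v₀≢v₀

        s₂≈s₁ : ∀ u → s₂ u ≈[ k₁ ] s₁ u
        s₂≈s₁ u i i<k₁ with decide (u ≡ u₀) | decide (u ≡ v₀)
        ... | yes refl | _ = cong proj₁ (z≈ i i<k₁)
        ... | no _ | yes refl = cong proj₂ (z≈ i i<k₁)
        ... | no _ | no _ = refl

    -- The fusion along the binary tree.

    Node : ℕ → Set
    Node zero = ⊤
    Node (suc n) = Node n × Bool

    restrict : ∀ n → (ℕ → Bool) → Node n
    restrict zero x = tt
    restrict (suc n) x = restrict n x , x n

    restrict-cong : ∀ n x y → x ≈[ n ] y → restrict n x ≡ restrict n y
    restrict-cong zero x y e = refl
    restrict-cong (suc n) x y e =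
      cong₂ _,_ (restrict-cong n x y (≈-mono (ℕ.n≤1+n n) e)) (e n ℕ.≤-refl)

    restrict-≢ : ∀ k n x y → x n ≢ y n → restrict (k ℕ.+ suc n) x ≢ restrict (k ℕ.+ suc n) y
    restrict-≢ zero n x y xn≢yn eq = xn≢yn (cong proj₂ eq)
    restrict-≢ (suc k) n x y xn≢yn eq = restrict-≢ k n x y xn≢yn (cong proj₁ eq)

    nodes : ∀ n → List (Node n)
    nodes zero = tt ∷ []
    nodes (suc n) = cartesianProduct (nodes n) (false ∷ true ∷ [])

    ∈-nodes : ∀ n u → u ∈ˡ nodes n
    ∈-nodes zero tt = here refl
    ∈-nodes (suc n) (u , false) = ∈-cartesianProduct⁺ (∈-nodes n u) (here refl)
    ∈-nodes (suc n) (u , true) = ∈-cartesianProduct⁺ (∈-nodes n u) (there (here refl))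

    -- Every ordered pair of distinct nodes carries a code, so `R′` is secured in both directions.
    record Stage (n : ℕ) : Set (Level.suc 0ℓ ⊔ a) where
      field
        seq   : Node n → ℕ → Bool
        len   : ℕ
        σ     : Node n → Node n → ℕ → ℕ
        long  : n ℕ.< len
        thick : ∀ u v → u ≢ v → Thick (σ u v) (suc n) (both (seq u) (seq v)) len

    open Stage

    initial : Stage 0
    initial = record
      { seq   = λ _ _ → false
      ; len   = 1
      ; σ     = λ _ _ _ → 0
      ; long  = s≤s z≤n
      ; thick = λ u v u≢v → contradiction refl u≢v
      }

    Step : ∀ {n} → Stage n → Stage (suc n) → Set
    Step {n} S T = len S ℕ.≤ len T ×
      (∀ u b → seq T (u , b) ≈[ len S ] seq S u) ×
      (∀ u v b c → u ≢ v → σ T (u , b) (v , c) ≈[ suc n ] σ S u v)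

    -- Siblings start a fresh code of length 0, thick by `thick-0`; other pairs continue the code of
    -- their parents.
    advance : ∀ n (S : Stage n) → Σ (Stage (suc n)) (Step S)
    advance n S = T , ℕ.≤-trans len≤l (ℕ.m≤m⊔n l _) , (λ u b → s≈ (u , b)) , σ-agrees
      where
      depth : ∀ {u v : Node n} → Dec (u ≡ v) → ℕ
      depth (yes _) = 0
      depth (no _) = suc n

      m : Node (suc n) → Node (suc n) → ℕ
      m (u , _) (v , _) = depth (decide (u ≡ v))

      thick₀ : ∀ u v → u ≢ v →
               Thick (σ S (proj₁ u) (proj₁ v)) (m u v) (both (seq S (proj₁ u)) (seq S (proj₁ v))) (len S)
      thick₀ (u , _) (v , _) _ with decide (u ≡ v)
      ... | yes _ = thick-0 _ _ _
      ... | no u≢v = thick S u v u≢v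

      pairs = cartesianProduct (nodes (suc n)) (nodes (suc n))
      refinement = thick-refine-all (λ u → seq S (proj₁ u)) (len S)
        (λ u v → σ S (proj₁ u) (proj₁ v)) m thick₀ (suc (suc n)) pairs
      s = proj₁ refinement
      l = proj₁ (proj₂ refinement)
      len≤l = proj₁ (proj₂ (proj₂ refinement))
      s≈ = proj₁ (proj₂ (proj₂ (proj₂ refinement)))

      refined : ∀ u v → u ≢ v → Refined (λ u → seq S (proj₁ u)) (len S)
        (λ u v → σ S (proj₁ u) (proj₁ v)) m thick₀ (suc (suc n)) u v s l
      refined u v = proj₂ (proj₂ (proj₂ (proj₂ refinement))) u v
        (∈-cartesianProduct⁺ (∈-nodes (suc n) u) (∈-nodes (suc n) v))

      σ′ : ∀ u v → Dec (u ≡ v) → ℕ → ℕ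
      -- A default on the diagonal, where `thick` makes no demand.
      σ′ u v (yes _) = λ _ → 0
      σ′ u v (no u≢v) = proj₁ (refined u v u≢v)

      thick′ : ∀ u v (u≟v : Dec (u ≡ v)) → u ≢ v → Thick (σ′ u v u≟v) (suc (suc n)) (both (s u) (s v)) l
      thick′ u v (yes u≡v) u≢v = contradiction u≡v u≢v
      thick′ u v (no u≢v) _ = proj₂ (proj₂ (refined u v u≢v))

      T : Stage (suc n)
      T = record
        { seq   = s
        ; len   = l ℕ.⊔ suc (suc n)
        ; σ     = λ u v → σ′ u v (decide _)
        ; long  = ℕ.m≤n⊔m l _
        ; thick = λ u v u≢v → thick-≤ (ℕ.m≤m⊔n l _) ≈-refl (thick′ u v (decide _) u≢v)
        }

      agrees : ∀ u v b c (uv? : Dec ((u , b) ≡ (v , c))) → u ≢ v →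
               σ′ (u , b) (v , c) uv? ≈[ suc n ] σ S u v
      agrees u v b c (yes eq) u≢v = contradiction (cong proj₁ eq) u≢v
      agrees u v b c (no ub≢vc) u≢v with decide (u ≡ v) | proj₁ (proj₂ (refined (u , b) (v , c) ub≢vc))
      ... | yes u≡v | _ = contradiction u≡v u≢v
      ... | no _ | σ≈ = ≈-sym σ≈

      σ-agrees : ∀ u v b c → u ≢ v → σ T (u , b) (v , c) ≈[ suc n ] σ S u v
      σ-agrees u v b c = agrees u v b c (decide _)

    stage : ∀ n → Stage n
    stage zero = initial
    stage (suc n) = proj₁ (advance n (stage n))

    step : ∀ n → Step (stage n) (stage (suc n))
    step n = proj₂ (advance n (stage n))

    θ-approx : (ℕ → Bool) → ℕ → ℕ → Bool
    θ-approx x n = seq (stage n) (restrict n x)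

    θ : (ℕ → Bool) → ℕ → Bool
    θ x = diagonal (θ-approx x)

    θ-≈ : ∀ x n → θ x ≈[ len (stage n) ] θ-approx x n
    θ-≈ x = diagonal-≈ (θ-approx x) (λ n → len (stage n)) (λ n → long (stage n))
      (λ n → proj₁ (step n)) (λ n → proj₁ (proj₂ (step n)) (restrict n x) (x n))

    θ-cong : ∀ n x y → x ≈[ n ] y → θ x ≈[ n ] θ y
    θ-cong n x y e i i<n =
      cong (λ u → seq (stage i) u i) (restrict-cong i x y (≈-mono (ℕ.<⇒≤ i<n) e))

    ψ : (ℕ → Bool) → X
    ψ x = φ (θ x)

    ψ-continuous : SeqContinuous τ ψ
    ψ-continuous V oV x ψx∈V =
      let n , near = φ-continuous V oV (θ x) ψx∈V
      in  n , λ y x≈y → near (θ y) (θ-cong n x y x≈y)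

    thick⇒coded : ∀ {α m z k} → Thick α m z k → ∃[ y ] y ∈ (Coded α m ↾ z , k)
    thick⇒coded thick = by-contradiction λ none →
      thick _ _ ℕ.≤-refl ≈-refl (meager-empty λ y y∈ → none (y , y∈))

    -- Beyond level `n` the nodes of `x` and `y` differ, so their codes converge to `α`. Thick boxes
    -- contain coded pairs, which converge to `θ x` and `θ y` while their witnesses converge to `α`.
    ψ-clique : ∀ x y n → x n ≢ y n → R′ (ψ x) (ψ y)
    ψ-clique x y n xn≢yn = subst₂ R′ (eq false) (eq true) (sound α)
      where
      lev : ℕ → ℕ
      lev k = k ℕ.+ suc n

      αs : ℕ → ℕ → ℕ
      αs k = σ (stage (lev k)) (restrict (lev k) x) (restrict (lev k) y)

      α : ℕ → ℕ
      α = diagonal αs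

      α-≈ : ∀ k → α ≈[ suc (lev k) ] αs k
      α-≈ = diagonal-≈ αs (λ k → suc (lev k)) (λ k → s≤s (ℕ.m≤m+n k (suc n))) (λ _ → ℕ.n≤1+n _)
        λ k → proj₂ (proj₂ (step (lev k))) _ _ (x (lev k)) (y (lev k)) (restrict-≢ k n x y xn≢yn)

      coded : ∀ k → ∃[ z ] z ∈ (Coded (αs k) (suc (lev k)) ↾
                                 both (θ-approx x (lev k)) (θ-approx y (lev k)) , len (stage (lev k)))
      coded k = thick⇒coded (thick (stage (lev k)) _ _ (restrict-≢ k n x y xn≢yn))

      k≤lev : ∀ k → k ℕ.≤ suc (lev k)
      k≤lev k = ℕ.m≤n⇒m≤1+n (ℕ.m≤m+n k (suc n))

      k≤len : ∀ k → k ℕ.≤ len (stage (lev k))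
      k≤len k = ℕ.≤-trans (k≤lev k) (long (stage (lev k)))

      z-≈ : ∀ k → proj₁ (coded k) ≈[ k ] both (θ-approx x (lev k)) (θ-approx y (lev k))
      z-≈ k = ≈-mono (k≤len k) (proj₁ (proj₂ (coded k)))

      β : ℕ → ℕ → ℕ
      β k = proj₁ (proj₂ (proj₂ (coded k)))

      β-lim : ∀ k → α ≈[ k ] β k
      β-lim k = ≈-mono (k≤lev k) (≈-trans (α-≈ k) (proj₁ (proj₂ (proj₂ (proj₂ (coded k))))))

      eq : ∀ b → code b α ≡ ψ (if b then y else x)
      eq false = limits-coincide τ hausdorff (continuous false) φ-continuous α (θ x) β
        (λ k → proj₁ ∘ proj₁ (coded k)) β-lim
        (λ k → ≈-trans (≈-mono (k≤len k) (θ-≈ x (lev k))) (≈-sym (≈-map proj₁ (z-≈ k))))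
        λ k → proj₁ (proj₂ (proj₂ (proj₂ (proj₂ (coded k)))))
      eq true = limits-coincide τ hausdorff (continuous true) φ-continuous α (θ y) β
        (λ k → proj₂ ∘ proj₁ (coded k)) β-lim
        (λ k → ≈-trans (≈-mono (k≤len k) (θ-≈ y (lev k))) (≈-sym (≈-map proj₂ (z-≈ k))))
        λ k → proj₂ (proj₂ (proj₂ (proj₂ (proj₂ (coded k)))))

  -- Perfectness of continuous images of Cantor space.

  module _ {X : Set a} (τ : Topology X a o) (hausdorff : Hausdorff τ)
    (ψ : (ℕ → Bool) → X) (ψ-continuous : SeqContinuous τ ψ) where

    Image : Pred X a
    Image x = ∃[ z ] ψ z ≡ x

    -- König's lemma: otherwise there is a z such that the image of every box
    -- around z meets every neighbourhood of x, whence ψ z ≡ x.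
    apart-from-image : ∀ x → x ∉ Image → ∃[ V ] Open τ V × x ∈ V × (∀ z → ¬ (ψ z ∈ V))
    apart-from-image x x∉ = by-contradiction λ none →
      let start : Clusters (λ _ → false) 0
          start V oV x∈V = by-contradiction λ ¬meets →
            none (V , oV , x∈V , λ z ψz∈V → ¬meets (z , (λ _ ()) , ψz∈V))
      in  no-branch start
      where
      -- `x` lies in the closure of the image of the box.
      Clusters : (ℕ → Bool) → ℕ → Set _
      Clusters z n = ∀ V → Open τ V → x ∈ V → ∃[ y ] y ≈[ n ] z × ψ y ∈ V

      separator : ∀ z n → ¬ Clusters z n →
        ∃[ V ] Open τ V × x ∈ V × (∀ y → y ≈[ n ] z → ¬ (ψ y ∈ V))
      separator z n ¬clusters = by-contradiction λ none → ¬clusters λ V oV x∈V →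
        by-contradiction λ ¬meets → none (V , oV , x∈V , λ y y≈z ψy∈V → ¬meets (y , y≈z , ψy∈V))

      -- Otherwise the neighbourhoods missed by the two halves intersect in one missed by the whole
      -- box.
      split : ∀ z n → Clusters z n → ∃[ b ] Clusters (z [ n ]≔ b) (suc n)
      split z n clusters = by-contradiction λ none →
        let sep : ∀ b → ∃[ V ] Open τ V × x ∈ V × (∀ y → y ≈[ suc n ] z [ n ]≔ b → ¬ (ψ y ∈ V))
            sep b = separator (z [ n ]≔ b) (suc n) λ c → none (b , c)
            V₀ , o₀ , x∈V₀ , _ = sep false
            V₁ , o₁ , x∈V₁ , _ = sep true
            y , y≈z , y∈V₀ , y∈V₁ = clusters (V₀ ∩ V₁) (Topology.open-∩ τ o₀ o₁) (x∈V₀ , x∈V₁)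
            y∈ : ∀ b → ψ y ∈ proj₁ (sep b)
            y∈ = λ { false → y∈V₀ ; true → y∈V₁ }
        in  proj₂ (proj₂ (proj₂ (sep (y n)))) y (≈-extend y≈z) (y∈ (y n))

      no-branch : ¬ Clusters (λ _ → false) 0
      no-branch start =
        let V , W , oV , oW , ψz∈V , x∈W , disjoint = hausdorff (ψ z) x λ eq → x∉ (z , eq)
            n , near = ψ-continuous V oV z ψz∈V
            y , y≈w , ψy∈W = proj₂ (branch (suc n)) W oW x∈W
        in  disjoint (ψ y) (near y (≈-mono (ℕ.n≤1+n n) (≈-trans (limit n) (≈-sym y≈w)))) ψy∈W
        where
        branch : ∀ n → ∃[ w ] Clusters w n
        branch zero = _ , start
        branch (suc n) = let w , c = branch n in w [ n ]≔ proj₁ (split w n c) , proj₂ (split w n c)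

        w : ℕ → ℕ → Bool
        -- The shift by one ensures that entry `n` of `w n` is already final.
        w n = proj₁ (branch (suc n))

        z : ℕ → Bool
        z = diagonal w

        limit : ∀ n → z ≈[ suc n ] w n
        limit = diagonal-≈ w suc (λ _ → ℕ.≤-refl) (λ _ → ℕ.n≤1+n _) (λ n → updated-≈ (w n) (suc n) _)

    -- The neighbourhoods from `apart-from-image` make up the complement. Flipping a late bit of `z`
    -- gives another point of the image close to `ψ z`.
    image-perfect : (∀ x y n → x n ≢ y n → ψ x ≢ ψ y) → Perfect τ Image
    image-perfect injective = (ψ (λ _ → false) , _ , refl) , closed , not-isolated
      where
      neighbourhood : (p : ∃[ x ] x ∉ Image) → Pred X a
      neighbourhood (x , x∉) = proj₁ (apart-from-image x x∉)

      closed : Open τ (∁ Image)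
      closed = Topology.open-resp τ
        ( (λ { ((x , x∉) , y∈V) (z , refl) → proj₂ (proj₂ (proj₂ (apart-from-image x x∉))) z y∈V })
        , λ {x} x∉ → (x , x∉) , proj₁ (proj₂ (proj₂ (apart-from-image x x∉))))
        (Topology.open-⋃ τ neighbourhood λ { (x , x∉) → proj₁ (proj₂ (apart-from-image x x∉)) })

      not-isolated : ∀ x → x ∈ Image → ¬ Isolated τ Image x
      not-isolated x (z , refl) (V , oV , ψz∈V , alone) =
        let n , near = ψ-continuous V oV z ψz∈V
            z′ = z [ n ]≔ not (z n)
        in  injective z′ z n (λ eq → not-¬ refl (trans (sym eq) (updated z n _)))
              (alone (ψ z′) (z′ , refl) (near z′ (≈-sym (updated-≈ z n _))))

  -- Metric spaces are Hausdorff.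

  module _ {X : Set a} {ρ : X → X → ℝ} (metric : IsMetric ρ) where
    open IsMetric metric
    open IsPseudoMetric isPseudoMetric

    ball : X → ℚ → Pred X a
    ball x r y = Lift a (ρ x y < fromℚ r)

    ball-open : ∀ x r → MetricOpen ρ (ball x r)
    ball-open x r y (lift (q , q∉ , q<r)) =
      fromℚ (r ℚ.- q) , 0<fromℚ (subst (ℚ._< r ℚ.- q) (ℚ.+-inverseʳ q) (ℚ.+-monoˡ-< (ℚ.- q) q<r))
      , λ { z (p , p∉ , p<r-q) → lift (q ℚ.+ p , +-bound (ρ x y) (ρ y z) (ρ x z) (triangle x y z) q∉ p∉
              , subst (q ℚ.+ p ℚ.<_) (p+[q-p]≡q q r) (ℚ.+-monoʳ-< q p<r-q)) }

    ball-center : ∀ x {r} → 0ℚ ℚ.< r → x ∈ ball x r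
    ball-center x 0<r = lift (0ℚ , (λ 0∈ → ℚ.<-irrefl refl (proj₁ (reflexive x) 0∈)) , 0<r)

    positive-distance : ∀ x y → x ≢ y → ∃[ q ] 0ℚ ℚ.< q × q ∈ cut (ρ x y)
    positive-distance x y x≢y = by-contradiction λ none → x≢y (separated x y
      ( (λ {p} p∈ → ℚ.≰⇒> λ 0≤p →
          let q , p<q , q∈ = open-up (ρ x y) p∈ in none (q , ℚ.≤-<-trans 0≤p p<q , q∈))
      , nonNegative x y))

    -- The balls have half the radius of a positive rational below the distance, so a common point
    -- would violate the triangle inequality.
    metric-hausdorff : (τ : Topology X a o) → (∀ V → Open τ V ⇔ MetricOpen ρ V) → Hausdorff τ
    metric-hausdorff τ open⇔ x y x≢y =
      let q , 0<q , q∈ = positive-distance x y x≢y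
          h , 0<h , h+h≡q = half 0<q
      in  ball x h , ball y h
          , Equivalence.from (open⇔ _) (ball-open x h) , Equivalence.from (open⇔ _) (ball-open y h)
          , ball-center x 0<h , ball-center y 0<h
          , λ { z (lift (s , s∉ , s<h)) (lift (t , t∉ , t<h)) →
                +-bound (ρ x z) (ρ z y) (ρ x y) (triangle x z y) s∉ (λ t∈ → t∉ (proj₁ (symmetric z y) t∈))
                  (lower (ρ x y) (subst (s ℚ.+ t ℚ.<_) h+h≡q (ℚ.+-mono-< s<h t<h)) q∈) }

  -- Parametrised form of nonempty analytic relations.

  module _ {X : Set a} (τ : Topology X a o) where

    analyticRelation : {R : X → X → Set ℓ} → Analytic (τ ⊗ τ) (λ (u , v) → R u v) →
                       (∀ u v → ¬ R u v) ⊎ AnalyticRelation τ R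
    analyticRelation (inj₁ empty) = inj₁ λ u v → empty (u , v)
    analyticRelation (inj₂ (f , f-continuous , range)) = inj₂ record
      { code       = λ b → component b ∘ f
      ; continuous = λ b V oV α fα∈V → f-continuous (component-open b oV) α fα∈V
      ; sound      = λ α → Equivalence.from (range (f α)) (α , refl)
      ; complete   = λ Ruv → let α , eq = Equivalence.to (range _) Ruv
                             in  α , cong proj₁ eq , cong proj₂ eq
      }
      where
      component : Bool → X × X → X
      component false = proj₁
      component true = proj₂

      component-open : ∀ b {V} → Open τ V → Open (τ ⊗ τ) (component b ⊢ V)
      component-open false oV p p∈V =
        _ , (λ _ → Lift a ⊤) , oV , Topology.open-univ τ (λ _ → lift tt) , (p∈V , lift tt) , proj₁
      component-open true oV p p∈V =
        (λ _ → Lift a ⊤) , _ , Topology.open-univ τ (λ _ → lift tt) , oV , (lift tt , p∈V) , proj₂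

  -- The relations given by the pseudo-metric.

  module _ {X : Set a} (d : X → X → ℝ) where

    -- Written as a negation to be literally the complement occurring in `Coanalytic`.
    Far : ℚ → X → X → Set
    Far δ u v = ¬ (d u v < fromℚ δ)

    colorable⇒separable : (∀ k → Colorable {ℓ′ = 0ℓ} (Far (unitFraction k)) (λ _ → ⊤)) →
                          PseudoMetricSeparable d
    colorable⇒separable colorable = S , (index , index-injective) , approximates
      where
      color : ℕ → X → ℕ
      color k = proj₁ (colorable k)

      class : ∀ k m → Dec (∃[ x ] color k x ≡ m)
      class k m = decide _

      -- The equation with `class k m` pins down the representative, so that `k` and `m` determine
      -- the point.
      S : Pred X a
      S x = ∃[ k ] ∃[ m ] ∃[ p ] class k m ≡ yes p × proj₁ p ≡ x

      indexOf : ∀ {x} → Dec (x ∈ S) → ℕ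
      indexOf (yes (k , m , _)) = pair k m
      indexOf (no _) = 0

      index : X → ℕ
      index x = indexOf (decide (x ∈ S))

      same-class : ∀ {x y} (p : x ∈ S) (q : y ∈ S) →
        (proj₁ p , proj₁ (proj₂ p)) ≡ (proj₁ q , proj₁ (proj₂ q)) → x ≡ y
      same-class (k , m , p , eq , refl) (_ , _ , q , eq′ , refl) refl with trans (sym eq) eq′
      ... | refl = refl

      index-injective : ∀ x y → x ∈ S → y ∈ S → index x ≡ index y → x ≡ y
      index-injective x y x∈S y∈S eq with decide (x ∈ S) | decide (y ∈ S)
      ... | yes p | yes q = same-class p q (pair-injective eq)
      ... | no x∉S | _ = contradiction x∈S x∉S
      ... | _ | no y∉S = contradiction y∈S y∉S

      approximates : ∀ u ε → 0ℝ < ε → ∃[ s ] s ∈ S × d u s < ε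
      -- `q` may be 0; openness of the cut supplies a positive `q′` still below `ε`.
      approximates u ε (q , q≮0 , q∈ε) with open-up ε q∈ε
      ... | q′ , q<q′ , q′∈ε with unitFraction-≤ (ℚ.≤-<-trans (ℚ.≮⇒≥ q≮0) q<q′)
      ...   | k , unit≤q′ with class k (color k u) in eq
      ...     | no empty = contradiction (u , refl) empty
      ...     | yes (s , same) =
        let r , r∉ , r<unit = by-contradiction (proj₂ (colorable k) u s tt tt (sym same))
        in  s , (k , color k u , (s , same) , eq , refl)
            , r , r∉ , lower ε (ℚ.<-≤-trans r<unit unit≤q′) q′∈ε

    module _ (pseudo : IsPseudoMetric d) where
      open IsPseudoMetric pseudo

      far-splits : ∀ {δ h} → h ℚ.+ h ≡ δ → ∀ u v → Far δ u v → ∀ w → Far h u w ⊎ Far h v w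
      far-splits {δ} {h} h+h≡δ u v far w with decide (d u w < fromℚ h) | decide (d v w < fromℚ h)
      ... | no far′ | _ = inj₁ far′
      ... | yes _ | no far′ = inj₂ far′
      ... | yes (p , p∉ , p<h) | yes (q , q∉ , q<h) = contradiction
        ( p ℚ.+ q , +-bound (d u w) (d w v) (d u v) (triangle u w v) p∉ (λ q∈ → q∉ (proj₁ (symmetric w v) q∈))
        , subst (p ℚ.+ q ℚ.<_) h+h≡δ (ℚ.+-mono-< p<h q<h)) far

      far-irreflexive : ∀ {h} → 0ℚ ℚ.< h → ∀ u → ¬ Far h u u
      far-irreflexive 0<h u far = far
        (0ℚ , (λ 0∈ → ℚ.<-irrefl refl (proj₁ (reflexive u) 0∈)) , 0<h)

    far⇒≤ : ∀ {h u v} → Far h u v → fromℚ h ≤ d u v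
    far⇒≤ far {q} q<h = by-contradiction λ q∉ → far (q , q∉ , q<h)

  -- Assembling the dichotomy.

  perfect-clique : {X : Set a} (τ : Topology X a o) → Hausdorff τ →
    {R : X → X → Set ℓ} {R′ : X → X → Set ℓ′} →
    Analytic (τ ⊗ τ) (λ (u , v) → R u v) → Analytic (τ ⊗ τ) (λ (u , v) → R′ u v) →
    (∀ u v → R u v → ∀ w → R′ u w ⊎ R′ v w) → (∀ u → ¬ R′ u u) →
    ¬ Colorable {ℓ′ = 0ℓ} R (λ _ → ⊤) →
    Σ (Pred X a) λ C → Perfect τ C × (∀ u v → u ∈ C → v ∈ C → u ≢ v → R′ u v)
  perfect-clique τ hausdorff {R} {R′} R-analytic R′-analytic splits irreflexive uncolorable
    with analyticRelation τ R-analytic | analyticRelation τ R′-analytic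
  ... | inj₁ empty | _ =
    contradiction (independent-colorable λ u v _ _ → empty u v) uncolorable
  ... | inj₂ R-rel | inj₁ empty = contradiction
    -- If `R′` is empty then so is `R`, by splitting an edge at its own endpoint.
    (independent-colorable λ u v _ _ Ruv → case splits u v Ruv u of λ where
      (inj₁ r) → empty _ _ r
      (inj₂ r) → empty _ _ r) uncolorable
  ... | inj₂ R-rel | inj₂ R′-rel =
    Image τ hausdorff ψ ψ-continuous
    , image-perfect τ hausdorff ψ ψ-continuous
        -- Injectivity comes from irreflexivity: equal images would be `R′`-related to themselves.
        (λ x y n xn≢yn eq → irreflexive (ψ y) (subst (λ u → R′ u (ψ y)) eq (ψ-clique x y n xn≢yn)))
    , λ { _ _ (x , refl) (y , refl) ψx≢ψy →
          let n , xn≢yn = ¬∀⇒∃¬ λ x≗y → ψx≢ψy (continuous-resp τ hausdorff ψ-continuous x y x≗y)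
          in  ψ-clique x y n xn≢yn }
    where
    module Hom = G₀ Cantor.dense τ hausdorff R-rel uncolorable
    open Clique τ hausdorff R′-rel splits Hom.φ Hom.φ-continuous Hom.φ-homomorphism

theorem1p2 : (∀ ℓ → ExcludedMiddle ℓ) →
    ∀ {a o : Level} (X : Set a) (τ : Topology X a o) → IsPolish τ →
    (d : X → X → ℝ) → IsPseudoMetric d →
    (∀ δ → 0ℝ < δ → Coanalytic (τ ⊗ τ) (λ (u , v) → d u v < δ)) →
    PseudoMetricSeparable d ⊎
    (∃[ δ ] 0ℝ < δ × (Σ (Pred X a) λ C → Perfect τ C ×
    (∀ u v → u ∈ C → v ∈ C → u ≢ v → δ ≤ d u v)))
theorem1p2 em X τ (_ , ρ , metric , _ , open⇔) d pseudo coanalytic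
  with Classical.decide em (∀ k → Classical.Colorable em {ℓ′ = 0ℓ} (Classical.Far em d (unitFraction k)) (λ _ → ⊤))
... | yes colorable = inj₁ (Classical.colorable⇒separable em d colorable)
... | no ¬colorable =
  let open Classical em
      k , uncolorable = ¬∀⇒∃¬ ¬colorable
      0<δ = ℚ.positive⁻¹ (unitFraction k)
      -- Uncolorability holds at `δ`, but the triangle inequality yields a clique only at half that
      -- distance.
      h , 0<h , h+h≡δ = half 0<δ
      C , perfect , clique = perfect-clique τ (metric-hausdorff metric τ open⇔)
        (coanalytic (fromℚ (unitFraction k)) (0<fromℚ 0<δ)) (coanalytic (fromℚ h) (0<fromℚ 0<h))
        (far-splits d pseudo h+h≡δ) (far-irreflexive d pseudo 0<h) uncolorable
  in  inj₂ (fromℚ h , 0<fromℚ 0<h , C , perfect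
      , λ u v u∈C v∈C u≢v → far⇒≤ d (clique u v u∈C v∈C u≢v))
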